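{- Let $p$ be an odd prime. Then $|L_p(n)|\ll\log n$ as $n\to\infty$; furthermore, $$\max_{n\le x}|L_p(n)|\asymp\log x$$ as $x\to\infty$, where the implied constants may depend on $p$.
   Context: For an odd prime $p$, $\lambda_p$ is the completely multiplicative function with $\lambda_p(p)=1$ and $\lambda_p(q)=\left(\frac{q}{p}\right)$ (Legendre symbol) for primes $q\ne p$, and $L_p(n):=\sum_{k=1}^n\lambda_p(k)$. The maximum is over positive integers $n\le x$. $F\ll G$ means $|F|\le C\,G$ for some constant $C>0$ and all sufficiently large arguments, and $F\asymp G$ means $F\ll G$ and $G\ll F$. -}

module Defs where

open import Data.Bool.Base using (if_then_else_)
open import Data.Nat.Base as ℕ using (ℕ; zero; suc; NonZero)
import Data.Nat.Properties as ℕₚ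
open import Data.Nat.Divisibility using (_∣_; _∣?_)
open import Data.Nat.ListAction using (product)
open import Data.Nat.ListAction.Properties using (product-++)
open import Data.Nat.Primality using (Prime; prime⇒nonZero)
open import Data.Nat.Primality.Factorisation
  using (PrimeFactorisation; factors; factorise; factorisationUnique; primeFactorisation[p])
open import Data.Integer.Base as ℤ using (ℤ; +_; 0ℤ; 1ℤ; -1ℤ)
import Data.Integer.Properties as ℤₚ
import Data.Integer.DivMod as ℤDM
open import Data.Rational.Base as ℚ
  using (ℚ; 0ℚ; 1ℚ; ½; _/_; _+_; _-_; -_; _*_; _<_; ∣_∣; floor; toℚᵘ; ↧ₙ_)
  renaming (_≤_ to _≤ℚ_)
import Data.Rational.Properties as ℚₚ
import Data.Rational.Unnormalised.Base as ℚᵘ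
import Data.Rational.Unnormalised.Properties as ℚᵘₚ
import Algebra.Properties.AbelianGroup ℚₚ.+-0-abelianGroup as ℚ+
open import Data.Fin.Base using (Fin; toℕ)
open import Data.Fin.Properties using (any?)
open import Data.List.Base using (List; []; _∷_; map; foldr; _++_)
open import Data.List.Properties using (map-++)
open import Data.List.Relation.Unary.All.Properties using (++⁺)
open import Data.List.Relation.Binary.Permutation.Propositional using (↭⇒↭ₛ; _↭_)
open import Data.List.Relation.Binary.Permutation.Propositional.Properties using (map⁺)
open import Data.List.Relation.Binary.Permutation.Setoid.Properties using (foldr-commMonoid)
open import Algebra.Bundles using (CommutativeMonoid)
open import Data.Product.Base using (∃-syntax; _×_; _,_; proj₁; proj₂)
open import Data.Sum.Base using (inj₁; inj₂; [_,_]′)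
open import Data.Empty using (⊥-elim)
open import Relation.Nullary using (Dec; yes; no; ¬_; does; ¬¬-excluded-middle)
open import Relation.Binary.PropositionalEquality

------------------------------------------------------------------------
-- The function λ_p and its summatory function

IsSquareMod : ℕ → ℕ → Set
IsSquareMod p a = ∃[ x ] p ∣ ℕ.∣ toℕ {p} x ℕ.* toℕ x - a ∣

isSquareMod? : ∀ p a → Dec (IsSquareMod p a)
isSquareMod? p a = any? (λ x → p ∣? ℕ.∣ toℕ {p} x ℕ.* toℕ x - a ∣)

-- legendre a p is the symbol (a/p).
legendre : ℕ → ℕ → ℤ
legendre a p =
  if does (p ∣? a) then 0ℤ else
  if does (isSquareMod? p a) then 1ℤ else -1ℤ

lambdaAtPrime : ℕ → ℕ → ℤ
lambdaAtPrime p q = if does (q ℕₚ.≟ p) then 1ℤ else legendre q p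

productℤ : List ℤ → ℤ
productℤ = foldr ℤ._*_ 1ℤ

-- The extension of lambdaAtPrime p to a completely multiplicative function
-- on the positive integers; see lambda-prime and lambda-*.
lambda : (p n : ℕ) .{{_ : NonZero n}} → ℤ
lambda p n = productℤ (map (lambdaAtPrime p) (factors (factorise n)))

L : ℕ → ℕ → ℤ
L p zero    = 0ℤ
L p (suc n) = L p n ℤ.+ lambda p (suc n)

private
  productℤ-↭ : ∀ {xs ys} → xs ↭ ys → productℤ xs ≡ productℤ ys
  productℤ-↭ p = foldr-commMonoid M.setoid M.isCommutativeMonoid (↭⇒↭ₛ p)
    where module M = CommutativeMonoid ℤₚ.*-1-commutativeMonoid

  productℤ-++ : ∀ xs ys → productℤ (xs ++ ys) ≡ productℤ xs ℤ.* productℤ ys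
  productℤ-++ []       ys = sym (ℤₚ.*-identityˡ _)
  productℤ-++ (x ∷ xs) ys =
    trans (cong (x ℤ.*_) (productℤ-++ xs ys)) (sym (ℤₚ.*-assoc x _ _))

lambda-factors : ∀ p n .{{_ : NonZero n}} (f : PrimeFactorisation n) →
                 lambda p n ≡ productℤ (map (lambdaAtPrime p) (factors f))
lambda-factors p n f =
  productℤ-↭ (map⁺ (lambdaAtPrime p) (factorisationUnique (factorise n) f))

lambda-prime : ∀ p {q} (q-prime : Prime q) →
               lambda p q {{prime⇒nonZero q-prime}} ≡ lambdaAtPrime p q
lambda-prime p {q} q-prime =
  trans (lambda-factors p q {{prime⇒nonZero q-prime}} (primeFactorisation[p] q-prime))
        (ℤₚ.*-identityʳ _)

lambda-* : ∀ p m n .{{_ : NonZero m}} .{{_ : NonZero n}} →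
           lambda p (m ℕ.* n) {{ℕₚ.m*n≢0 m n}} ≡ lambda p m ℤ.* lambda p n
lambda-* p m n = begin
  lambda p (m ℕ.* n) {{ℕₚ.m*n≢0 m n}}
    ≡⟨ lambda-factors p (m ℕ.* n) {{ℕₚ.m*n≢0 m n}} f ⟩
  productℤ (map h (fs ++ gs))              ≡⟨ cong productℤ (map-++ h fs gs) ⟩
  productℤ (map h fs ++ map h gs)          ≡⟨ productℤ-++ (map h fs) (map h gs) ⟩
  lambda p m ℤ.* lambda p n                ∎
  where
  open ≡-Reasoning
  open PrimeFactorisation using (isFactorisation; factorsPrime)
  h  = lambdaAtPrime p
  fs = factors (factorise m)
  gs = factors (factorise n)
  f : PrimeFactorisation (m ℕ.* n)
  f = record
    { factors         = fs ++ gs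
    ; isFactorisation = trans
        (cong₂ ℕ._*_ (isFactorisation (factorise m)) (isFactorisation (factorise n)))
        (sym (product-++ fs gs))
    ; factorsPrime    = ++⁺ (factorsPrime (factorise m)) (factorsPrime (factorise n))
    }

------------------------------------------------------------------------
-- Real numbers as Cauchy sequences of rationals

IsCauchy : (ℕ → ℚ) → Set
IsCauchy x = ∀ ε → 0ℚ < ε →
  ∃[ N ] ∀ m n → N ℕ.≤ m → N ℕ.≤ n → ∣ x m - x n ∣ < ε

record ℝ : Set where
  constructor mkℝ
  field
    seq    : ℕ → ℚ
    cauchy : IsCauchy seq

open ℝ public

infix 4 _≤ᴿ_ _<ᴿ_

_≤ᴿ_ : ℝ → ℝ → Set
x ≤ᴿ y = ∀ ε → 0ℚ < ε → ∃[ N ] ∀ n → N ℕ.≤ n → seq x n ≤ℚ seq y n + ε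

_<ᴿ_ : ℝ → ℝ → Set
x <ᴿ y = ∃[ ε ] 0ℚ < ε × ∃[ N ] ∀ n → N ℕ.≤ n → seq x n + ε ≤ℚ seq y n

fromℚ : ℚ → ℝ
fromℚ q = mkℝ (λ _ → q) λ ε 0<ε → 0 , λ _ _ _ _ →
  subst (_< ε) (sym (cong ∣_∣ (ℚₚ.+-inverseʳ q))) 0<ε

fromℕ : ℕ → ℝ
fromℕ n = fromℚ (+ n / 1)

0ᴿ : ℝ
0ᴿ = fromℚ 0ℚ

open ℚₚ.≤-Reasoning

q+r-q≡r : ∀ q r → q + r - q ≡ r
q+r-q≡r = ℚ+.xyx⁻¹≈y

q+[p-q]≡p : ∀ p q → q + (p - q) ≡ p
q+[p-q]≡p p q = trans (sym (ℚₚ.+-assoc q p (- q))) (q+r-q≡r q p)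

-[p-q]≡q-p : ∀ p q → - (p - q) ≡ q - p
-[p-q]≡q-p = ℚ+.⁻¹-anti-homo‿-

[p-q]+[q-r]≡p-r : ∀ p q r → (p - q) + (q - r) ≡ p - r
[p-q]+[q-r]≡p-r p q r = trans (ℚₚ.+-assoc p (- q) (q - r))
  (cong (λ s → p + s) (trans (sym (ℚₚ.+-assoc (- q) q (- r)))
    (trans (cong (_- r) (ℚₚ.+-inverseˡ q)) (ℚₚ.+-identityˡ (- r)))))

p*[q-r] : ∀ p q r → p * (q - r) ≡ p * q - p * r
p*[q-r] p q r = trans (ℚₚ.*-distribˡ-+ p q (- r))
  (cong (λ s → p * q + s) (sym (ℚₚ.neg-distribʳ-* p r)))

ab-cd : ∀ a b c d → a * b - c * d ≡ a * (b - d) + d * (a - c)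
ab-cd a b c d = sym (trans
  (cong₂ _+_ (p*[q-r] a b d)
    (trans (p*[q-r] d a c) (cong₂ _-_ (ℚₚ.*-comm d a) (ℚₚ.*-comm d c))))
  ([p-q]+[q-r]≡p-r (a * b) (a * d) (c * d)))

0<⇒pos : ∀ {p} → 0ℚ < p → ℚ.Positive p
0<⇒pos = ℚ.positive

p-q≤r : ∀ {p q r} → p ≤ℚ q + r → p - q ≤ℚ r
p-q≤r {p} {q} {r} h = begin
  p - q       ≤⟨ ℚₚ.+-monoˡ-≤ (- q) h ⟩
  q + r - q   ≡⟨ q+r-q≡r q r ⟩
  r           ∎

p≤∣p∣ : ∀ p → p ≤ℚ ∣ p ∣
p≤∣p∣ p with ℚₚ.≤-total 0ℚ p
... | inj₁ 0≤p = ℚₚ.≤-reflexive (sym (ℚₚ.0≤p⇒∣p∣≡p 0≤p))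
... | inj₂ p≤0 = ℚₚ.≤-trans p≤0 (ℚₚ.0≤∣p∣ p)

∣p-q∣≡∣q-p∣ : ∀ p q → ∣ p - q ∣ ≡ ∣ q - p ∣
∣p-q∣≡∣q-p∣ p q = trans
  (cong ∣_∣ (sym (-[p-q]≡q-p q p)))
  (ℚₚ.∣-p∣≡∣p∣ (q - p))

∣p-q∣≤r : ∀ {p q r} → p ≤ℚ q + r → q ≤ℚ p + r → ∣ p - q ∣ ≤ℚ r
∣p-q∣≤r {p} {q} {r} h₁ h₂ with ℚₚ.∣p∣≡p∨∣p∣≡-p (p - q)
... | inj₁ e = subst (_≤ℚ r) (sym e) (p-q≤r {p} {q} {r} h₁)
... | inj₂ e = subst (_≤ℚ r)
  (sym (trans e (-[p-q]≡q-p p q))) (p-q≤r {q} {p} {r} h₂)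

p≤q+∣p-q∣ : ∀ p q → p ≤ℚ q + ∣ p - q ∣
p≤q+∣p-q∣ p q = begin
  p             ≡⟨ sym (q+[p-q]≡p p q) ⟩
  q + (p - q)   ≤⟨ ℚₚ.+-monoʳ-≤ q (p≤∣p∣ (p - q)) ⟩
  q + ∣ p - q ∣ ∎

∣p∣≤∣q∣+∣p-q∣ : ∀ p q → ∣ p ∣ ≤ℚ ∣ q ∣ + ∣ p - q ∣
∣p∣≤∣q∣+∣p-q∣ p q = begin
  ∣ p ∣             ≡⟨ cong ∣_∣ (sym (q+[p-q]≡p p q)) ⟩
  ∣ q + (p - q) ∣   ≤⟨ ℚₚ.∣p+q∣≤∣p∣+∣q∣ q (p - q) ⟩
  ∣ q ∣ + ∣ p - q ∣ ∎

∣∣p∣-∣q∣∣≤∣p-q∣ : ∀ p q → ∣ ∣ p ∣ - ∣ q ∣ ∣ ≤ℚ ∣ p - q ∣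
∣∣p∣-∣q∣∣≤∣p-q∣ p q = ∣p-q∣≤r {∣ p ∣} {∣ q ∣} (∣p∣≤∣q∣+∣p-q∣ p q)
  (subst (λ d → ∣ q ∣ ≤ℚ ∣ p ∣ + d) (∣p-q∣≡∣q-p∣ q p) (∣p∣≤∣q∣+∣p-q∣ q p))

half : ∀ {ε} → 0ℚ < ε → 0ℚ < ½ * ε
half {ε} 0<ε = ℚₚ.*-monoʳ-<-pos ½ 0<ε

half+half : ∀ ε → ½ * ε + ½ * ε ≡ ε
half+half ε = trans (sym (ℚₚ.*-distribʳ-+ ε ½ ½)) (ℚₚ.*-identityˡ ε)

∣_∣ᴿ : ℝ → ℝ
∣ x ∣ᴿ = mkℝ (λ k → ∣ seq x k ∣) λ ε 0<ε →
  let N , h = cauchy x ε 0<ε in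
  N , λ m n N≤m N≤n →
    ℚₚ.≤-<-trans (∣∣p∣-∣q∣∣≤∣p-q∣ (seq x m) (seq x n)) (h m n N≤m N≤n)

bound : (x : ℝ) → ∃[ B ] 0ℚ < B × ∃[ N ] ∀ n → N ℕ.≤ n → ∣ seq x n ∣ ≤ℚ B
bound x with cauchy x 1ℚ (ℚₚ.positive⁻¹ 1ℚ)
... | N , h = ∣ seq x N ∣ + 1ℚ , 0<B , N , λ n N≤n → begin
    ∣ seq x n ∣                         ≤⟨ ∣p∣≤∣q∣+∣p-q∣ (seq x n) (seq x N) ⟩
    ∣ seq x N ∣ + ∣ seq x n - seq x N ∣ ≤⟨ ℚₚ.+-monoʳ-≤ ∣ seq x N ∣ (ℚₚ.<⇒≤ (h n N N≤n ℕₚ.≤-refl)) ⟩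
    ∣ seq x N ∣ + 1ℚ                    ∎
  where
  0<B : 0ℚ < ∣ seq x N ∣ + 1ℚ
  0<B = ℚₚ.+-mono-≤-< (ℚₚ.0≤∣p∣ (seq x N)) (ℚₚ.positive⁻¹ 1ℚ)

-- δ = ε / 2B
shrink : ∀ B ε → 0ℚ < B → 0ℚ < ε → ∃[ δ ] 0ℚ < δ × B * δ ≡ ½ * ε
shrink B ε 0<B 0<ε = ℚ.1/_ B {{nz}} * (½ * ε) , 0<δ , eq
  where
  instance
    pos : ℚ.Positive B
    pos = 0<⇒pos 0<B
    nz : ℚ.NonZero B
    nz = ℚₚ.pos⇒nonZero B
    pos1/ : ℚ.Positive (ℚ.1/_ B {{nz}})
    pos1/ = ℚₚ.1/pos⇒pos B
  0<δ : 0ℚ < ℚ.1/_ B {{nz}} * (½ * ε)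
  0<δ = subst (_< ℚ.1/_ B {{nz}} * (½ * ε)) (ℚₚ.*-zeroʳ (ℚ.1/_ B {{nz}}))
    (ℚₚ.*-monoʳ-<-pos (ℚ.1/_ B {{nz}}) (half 0<ε))
  eq : B * (ℚ.1/_ B {{nz}} * (½ * ε)) ≡ ½ * ε
  eq = trans (sym (ℚₚ.*-assoc B _ _))
    (trans (cong (_* (½ * ε)) (ℚₚ.*-inverseʳ B)) (ℚₚ.*-identityˡ (½ * ε)))

*-cauchy : (x y : ℝ) → IsCauchy (λ k → seq x k * seq y k)
*-cauchy x y ε 0<ε
  with bound x | bound y
... | B , 0<B , N₁ , hB | C , 0<C , N₂ , hC
  with shrink B ε 0<B 0<ε | shrink C ε 0<C 0<ε
... | δ₁ , 0<δ₁ , e₁ | δ₂ , 0<δ₂ , e₂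
  with cauchy y δ₁ 0<δ₁ | cauchy x δ₂ 0<δ₂
... | M₁ , g₁ | M₂ , g₂ = N₁ ℕ.⊔ N₂ ℕ.⊔ (M₁ ℕ.⊔ M₂) , main
  where
  main : ∀ m n → N₁ ℕ.⊔ N₂ ℕ.⊔ (M₁ ℕ.⊔ M₂) ℕ.≤ m → N₁ ℕ.⊔ N₂ ℕ.⊔ (M₁ ℕ.⊔ M₂) ℕ.≤ n →
         ∣ seq x m * seq y m - seq x n * seq y n ∣ < ε
  main m n le-m le-n = begin-strict
    ∣ a * b - c * d ∣
      ≡⟨ cong ∣_∣ (ab-cd a b c d) ⟩
    ∣ a * (b - d) + d * (a - c) ∣
      ≤⟨ ℚₚ.∣p+q∣≤∣p∣+∣q∣ (a * (b - d)) (d * (a - c)) ⟩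
    ∣ a * (b - d) ∣ + ∣ d * (a - c) ∣
      ≡⟨ cong₂ _+_ (ℚₚ.∣p*q∣≡∣p∣*∣q∣ a (b - d)) (ℚₚ.∣p*q∣≡∣p∣*∣q∣ d (a - c)) ⟩
    ∣ a ∣ * ∣ b - d ∣ + ∣ d ∣ * ∣ a - c ∣
      ≤⟨ ℚₚ.+-mono-≤
           (ℚₚ.*-monoʳ-≤-nonNeg ∣ b - d ∣ {{ℚₚ.∣-∣-nonNeg (b - d)}} (hB m (N₁≤ le-m)))
           (ℚₚ.*-monoʳ-≤-nonNeg ∣ a - c ∣ {{ℚₚ.∣-∣-nonNeg (a - c)}} (hC n (N₂≤ le-n))) ⟩
    B * ∣ b - d ∣ + C * ∣ a - c ∣
      <⟨ ℚₚ.+-mono-<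
           (ℚₚ.*-monoʳ-<-pos B {{0<⇒pos 0<B}} (g₁ m n (M₁≤ le-m) (M₁≤ le-n)))
           (ℚₚ.*-monoʳ-<-pos C {{0<⇒pos 0<C}} (g₂ m n (M₂≤ le-m) (M₂≤ le-n))) ⟩
    B * δ₁ + C * δ₂
      ≡⟨ cong₂ _+_ e₁ e₂ ⟩
    ½ * ε + ½ * ε
      ≡⟨ half+half ε ⟩
    ε ∎
    where
    a = seq x m
    b = seq y m
    c = seq x n
    d = seq y n
    N₁≤ : ∀ {k} → N₁ ℕ.⊔ N₂ ℕ.⊔ (M₁ ℕ.⊔ M₂) ℕ.≤ k → N₁ ℕ.≤ k
    N₁≤ h = ℕₚ.m⊔n≤o⇒m≤o N₁ N₂ (ℕₚ.m⊔n≤o⇒m≤o (N₁ ℕ.⊔ N₂) (M₁ ℕ.⊔ M₂) h)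
    N₂≤ : ∀ {k} → N₁ ℕ.⊔ N₂ ℕ.⊔ (M₁ ℕ.⊔ M₂) ℕ.≤ k → N₂ ℕ.≤ k
    N₂≤ h = ℕₚ.m⊔n≤o⇒n≤o N₁ N₂ (ℕₚ.m⊔n≤o⇒m≤o (N₁ ℕ.⊔ N₂) (M₁ ℕ.⊔ M₂) h)
    M₁≤ : ∀ {k} → N₁ ℕ.⊔ N₂ ℕ.⊔ (M₁ ℕ.⊔ M₂) ℕ.≤ k → M₁ ℕ.≤ k
    M₁≤ h = ℕₚ.m⊔n≤o⇒m≤o M₁ M₂ (ℕₚ.m⊔n≤o⇒n≤o (N₁ ℕ.⊔ N₂) (M₁ ℕ.⊔ M₂) h)
    M₂≤ : ∀ {k} → N₁ ℕ.⊔ N₂ ℕ.⊔ (M₁ ℕ.⊔ M₂) ℕ.≤ k → M₂ ℕ.≤ k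
    M₂≤ h = ℕₚ.m⊔n≤o⇒n≤o M₁ M₂ (ℕₚ.m⊔n≤o⇒n≤o (N₁ ℕ.⊔ N₂) (M₁ ℕ.⊔ M₂) h)

infixl 7 _*ᴿ_

_*ᴿ_ : ℝ → ℝ → ℝ
x *ᴿ y = mkℝ (λ k → seq x k * seq y k) (*-cauchy x y)

------------------------------------------------------------------------
-- The natural logarithm

-- 1 / (n + 1) + ... + 1 / (n + m)
recipSum : ℕ → ℕ → ℚ
recipSum n zero    = 0ℚ
recipSum n (suc m) = recipSum n m + + 1 / suc (n ℕ.+ m)

excess : ℚ → ℚ
excess x = 0ℚ ℚ.⊔ (x - 1ℚ)

-- The number of whole steps of length 1 / (k + 1) from 1 to x (0 if x ≤ 1).
steps : ℕ → ℚ → ℕ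
steps k x = ℤ.∣ floor (+ suc k / 1 * excess x) ∣

-- log x = ∫₁ˣ dt/t for x ≥ 1, as the limit of its right-endpoint Riemann
-- sums: with K = k + 1, the nodes 1 + i/K contribute (1/K) · 1/(1 + i/K) = 1/(K + i).
-- For x ≤ 1 the sequence tends to the junk value 0.
logSeq : (ℕ → ℚ) → ℕ → ℚ
logSeq x k = recipSum (suc k) (steps k (x k))

ι : ℕ → ℚ
ι n = + n / 1

r : ℕ → ℚ
r n = + 1 / suc n

toℚᵘ-/ : ∀ i n → toℚᵘ (i / suc n) ℚᵘ.≃ ℚᵘ.mkℚᵘ i n
toℚᵘ-/ i n = ℚₚ.toℚᵘ-fromℚᵘ (ℚᵘ.mkℚᵘ i n)

ι-+ : ∀ a b → ι (a ℕ.+ b) ≡ ι a + ι b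
ι-+ a b = ℚₚ.toℚᵘ-injective (ℚᵘₚ.≃-trans (toℚᵘ-/ (+ (a ℕ.+ b)) 0)
  (ℚᵘₚ.≃-trans (ℚᵘ.*≡* eq)
  (ℚᵘₚ.≃-sym (ℚᵘₚ.≃-trans (ℚₚ.toℚᵘ-homo-+ (ι a) (ι b))
    (ℚᵘₚ.+-cong (toℚᵘ-/ (+ a) 0) (toℚᵘ-/ (+ b) 0))))))
  where
  eq : + (a ℕ.+ b) ℤ.* 1ℤ ≡ (+ a ℤ.* 1ℤ ℤ.+ + b ℤ.* 1ℤ) ℤ.* 1ℤ
  eq = cong (ℤ._* 1ℤ) (sym (cong₂ ℤ._+_ (ℤₚ.*-identityʳ (+ a)) (ℤₚ.*-identityʳ (+ b))))

ι-* : ∀ a b → ι (a ℕ.* b) ≡ ι a * ι b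
ι-* a b = ℚₚ.toℚᵘ-injective (ℚᵘₚ.≃-trans (toℚᵘ-/ (+ (a ℕ.* b)) 0)
  (ℚᵘₚ.≃-trans (ℚᵘ.*≡* (cong (ℤ._* 1ℤ) (ℤₚ.pos-* a b)))
  (ℚᵘₚ.≃-sym (ℚᵘₚ.≃-trans (ℚₚ.toℚᵘ-homo-* (ι a) (ι b))
    (ℚᵘₚ.*-cong (toℚᵘ-/ (+ a) 0) (toℚᵘ-/ (+ b) 0))))))

/-mono : ∀ a b c d → a ℕ.* suc d ℕ.≤ c ℕ.* suc b → + a / suc b ≤ℚ + c / suc d
/-mono a b c d h = ℚₚ.toℚᵘ-cancel-≤
  (ℚᵘₚ.≤-respˡ-≃ (ℚᵘₚ.≃-sym (toℚᵘ-/ (+ a) b))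
  (ℚᵘₚ.≤-respʳ-≃ (ℚᵘₚ.≃-sym (toℚᵘ-/ (+ c) d))
  (ℚᵘ.*≤* (subst₂ ℤ._≤_ (ℤₚ.pos-* a (suc d)) (ℤₚ.pos-* c (suc b)) (ℤ.+≤+ h)))))

ι-mono : ∀ {a b} → a ℕ.≤ b → ι a ≤ℚ ι b
ι-mono {a} {b} h = /-mono a 0 b 0 (ℕₚ.*-monoˡ-≤ 1 h)

r-mono : ∀ {a b} → a ℕ.≤ b → r b ≤ℚ r a
r-mono {a} {b} h = /-mono 1 b 1 a (ℕₚ.*-monoʳ-≤ 1 (ℕ.s≤s h))

ι-nonNeg : ∀ n → ℚ.NonNegative (ι n)
ι-nonNeg n = ℚₚ.normalize-nonNeg n 1

r-nonNeg : ∀ n → ℚ.NonNegative (r n)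
r-nonNeg n = ℚₚ.normalize-nonNeg 1 (suc n)

0≤r : ∀ n → 0ℚ ≤ℚ r n
0≤r n = ℚₚ.nonNegative⁻¹ (r n) {{r-nonNeg n}}

ι*r≡1 : ∀ n → ι (suc n) * r n ≡ 1ℚ
ι*r≡1 n = ℚₚ.toℚᵘ-injective (ℚᵘₚ.≃-trans (ℚₚ.toℚᵘ-homo-* (ι (suc n)) (r n))
  (ℚᵘₚ.≃-trans (ℚᵘₚ.*-cong (toℚᵘ-/ (+ suc n) 0) (toℚᵘ-/ (+ 1) n)) (ℚᵘ.*≡* eq)))
  where
  eq : (+ suc n ℤ.* + 1) ℤ.* + 1 ≡ + 1 ℤ.* + suc (n ℕ.+ 0)
  eq = trans (ℤₚ.*-identityʳ _) (trans (ℤₚ.*-identityʳ _)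
    (trans (cong (λ z → + suc z) (sym (ℕₚ.+-identityʳ n))) (sym (ℤₚ.*-identityˡ _))))

ι*r≡r : ∀ c n m → suc m ≡ suc c ℕ.* suc n → ι (suc c) * r m ≡ r n
ι*r≡r c n m e = begin-equality
  ι (suc c) * r m                         ≡⟨ sym (ℚₚ.*-identityʳ _) ⟩
  ι (suc c) * r m * 1ℚ                    ≡⟨ cong (ι (suc c) * r m *_) (sym (ι*r≡1 n)) ⟩
  ι (suc c) * r m * (ι (suc n) * r n)     ≡⟨ sym (ℚₚ.*-assoc (ι (suc c) * r m) (ι (suc n)) (r n)) ⟩
  ι (suc c) * r m * ι (suc n) * r n       ≡⟨ cong (_* r n) (ℚₚ.*-assoc (ι (suc c)) (r m) (ι (suc n))) ⟩
  ι (suc c) * (r m * ι (suc n)) * r n     ≡⟨ cong (λ z → ι (suc c) * z * r n) (ℚₚ.*-comm (r m) (ι (suc n))) ⟩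
  ι (suc c) * (ι (suc n) * r m) * r n     ≡⟨ cong (_* r n) (sym (ℚₚ.*-assoc (ι (suc c)) (ι (suc n)) (r m))) ⟩
  ι (suc c) * ι (suc n) * r m * r n       ≡⟨ cong (λ z → z * r m * r n) (sym (ι-* (suc c) (suc n))) ⟩
  ι (suc c ℕ.* suc n) * r m * r n         ≡⟨ cong (λ z → ι z * r m * r n) (sym e) ⟩
  ι (suc m) * r m * r n                   ≡⟨ cong (_* r n) (ι*r≡1 m) ⟩
  1ℚ * r n                                ≡⟨ ℚₚ.*-identityˡ (r n) ⟩
  r n                                     ∎

r↧<p : ∀ p → .{{_ : ℚ.Positive p}} → r (↧ₙ p) < p
r↧<p (ℚ.mkℚ (+ suc a) b _) = ℚₚ.toℚᵘ-cancel-<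
  (ℚᵘₚ.<-respˡ-≃ (ℚᵘₚ.≃-sym (toℚᵘ-/ (+ 1) (suc b)))
  (ℚᵘ.*<* (subst₂ ℤ._<_ (ℤₚ.pos-* 1 (suc b)) (ℤₚ.pos-* (suc a) (suc (suc b)))
    (ℤ.+<+ (subst (ℕ._< suc a ℕ.* suc (suc b)) (sym (ℕₚ.*-identityˡ (suc b)))
      (ℕₚ.m≤m+n (suc (suc b)) (a ℕ.* suc (suc b))))))))

archimedean : ∀ δ → 0ℚ < δ → ∃[ N ] ∀ n → N ℕ.≤ n → r n < δ
archimedean δ 0<δ = ↧ₙ δ , λ n h → ℚₚ.≤-<-trans (r-mono h) (r↧<p δ {{0<⇒pos 0<δ}})

floor-bounds : ∀ y → 0ℚ ≤ℚ y → ι ℤ.∣ floor y ∣ ≤ℚ y × y ≤ℚ ι ℤ.∣ floor y ∣ + 1ℚ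
floor-bounds y@(ℚ.mkℚ n d-1 _) 0≤y = lower , upper
  where
  d : ℕ
  d = suc d-1
  0≤n : 0ℤ ℤ.≤ n
  0≤n = ℤₚ.nonNegative⁻¹ n {{ℚ.nonNegative 0≤y}}
  q : ℤ
  q = n ℤ./ + d
  q≡ : + ℤ.∣ q ∣ ≡ q
  q≡ = ℤₚ.0≤i⇒+∣i∣≡i (ℤDM.0≤n⇒0≤n/d n (+ d) 0≤n (ℤ.+≤+ ℕ.z≤n))
  lower : ι ℤ.∣ q ∣ ≤ℚ y
  lower = ℚₚ.toℚᵘ-cancel-≤
    (ℚᵘₚ.≤-respˡ-≃ (ℚᵘₚ.≃-sym (toℚᵘ-/ (+ ℤ.∣ q ∣) 0))
    (ℚᵘ.*≤* (subst₂ ℤ._≤_ (cong (ℤ._* + d) (sym q≡)) (sym (ℤₚ.*-identityʳ n))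
      (ℤDM.[n/d]*d≤n n (+ d)))))
  upper′ : n ℤ.≤ + suc ℤ.∣ q ∣ ℤ.* + d
  upper′ = ℤₚ.<⇒≤ (subst (λ z → n ℤ.< ℤ.suc z ℤ.* + d)
    (trans (sym (ℤDM.div-pos-is-/ℕ n d)) (sym q≡)) (ℤDM.n<s[n/ℕd]*d n d))
  upper : y ≤ℚ ι ℤ.∣ q ∣ + 1ℚ
  upper = subst (y ≤ℚ_)
    (trans (cong ι (ℕₚ.+-comm 1 ℤ.∣ q ∣)) (ι-+ ℤ.∣ q ∣ 1))
    (ℚₚ.toℚᵘ-cancel-≤
      (ℚᵘₚ.≤-respʳ-≃ (ℚᵘₚ.≃-sym (toℚᵘ-/ (+ suc ℤ.∣ q ∣) 0))
      (ℚᵘ.*≤* (subst (ℤ._≤ + suc ℤ.∣ q ∣ ℤ.* + d) (sym (ℤₚ.*-identityʳ n)) upper′))))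

recipSum-+ : ∀ n m d → recipSum n (m ℕ.+ d) ≡ recipSum n m + recipSum (n ℕ.+ m) d
recipSum-+ n m zero = trans (cong (recipSum n) (ℕₚ.+-identityʳ m)) (sym (ℚₚ.+-identityʳ _))
recipSum-+ n m (suc d) = begin-equality
  recipSum n (m ℕ.+ suc d)                                     ≡⟨ cong (recipSum n) (ℕₚ.+-suc m d) ⟩
  recipSum n (m ℕ.+ d) + r (n ℕ.+ (m ℕ.+ d))
    ≡⟨ cong₂ _+_ (recipSum-+ n m d) (cong r (sym (ℕₚ.+-assoc n m d))) ⟩
  recipSum n m + recipSum (n ℕ.+ m) d + r (n ℕ.+ m ℕ.+ d)      ≡⟨ ℚₚ.+-assoc (recipSum n m) _ _ ⟩
  recipSum n m + (recipSum (n ℕ.+ m) d + r (n ℕ.+ m ℕ.+ d))    ∎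

ι-suc-* : ∀ d q → ι (suc d) * q ≡ ι d * q + q
ι-suc-* d q = begin-equality
  ι (suc d) * q      ≡⟨ cong (λ z → ι z * q) (ℕₚ.+-comm 1 d) ⟩
  ι (d ℕ.+ 1) * q    ≡⟨ cong (_* q) (ι-+ d 1) ⟩
  (ι d + 1ℚ) * q     ≡⟨ ℚₚ.*-distribʳ-+ q (ι d) 1ℚ ⟩
  ι d * q + 1ℚ * q   ≡⟨ cong (λ z → ι d * q + z) (ℚₚ.*-identityˡ q) ⟩
  ι d * q + q        ∎

recipSum-lower : ∀ n d b → n ℕ.+ d ℕ.≤ suc b → ι d * r b ≤ℚ recipSum n d
recipSum-lower n zero    b h = ℚₚ.≤-reflexive (ℚₚ.*-zeroˡ (r b))
recipSum-lower n (suc d) b h = begin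
  ι (suc d) * r b             ≡⟨ ι-suc-* d (r b) ⟩
  ι d * r b + r b             ≤⟨ ℚₚ.+-mono-≤ (recipSum-lower n d b (ℕₚ.m≤n⇒m≤1+n n+d≤b)) (r-mono n+d≤b) ⟩
  recipSum n d + r (n ℕ.+ d)  ∎
  where
  n+d≤b : n ℕ.+ d ℕ.≤ b
  n+d≤b = ℕₚ.≤-pred (subst (ℕ._≤ suc b) (ℕₚ.+-suc n d) h)

recipSum-upper : ∀ n d b → b ℕ.≤ n → recipSum n d ≤ℚ ι d * r b
recipSum-upper n zero    b h = ℚₚ.≤-reflexive (sym (ℚₚ.*-zeroˡ (r b)))
recipSum-upper n (suc d) b h = begin
  recipSum n d + r (n ℕ.+ d)  ≤⟨ ℚₚ.+-mono-≤ (recipSum-upper n d b h) (r-mono (ℕₚ.≤-trans h (ℕₚ.m≤m+n n d))) ⟩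
  ι d * r b + r b             ≡⟨ sym (ι-suc-* d (r b)) ⟩
  ι (suc d) * r b             ∎

recipSum-mono : ∀ n {a b} → a ℕ.≤ b → recipSum n a ≤ℚ recipSum n b
recipSum-mono n {a} {b} a≤b = begin
  recipSum n a                                   ≡⟨ sym (ℚₚ.+-identityʳ _) ⟩
  recipSum n a + 0ℚ                              ≤⟨ ℚₚ.+-monoʳ-≤ (recipSum n a) (nonneg (b ℕ.∸ a)) ⟩
  recipSum n a + recipSum (n ℕ.+ a) (b ℕ.∸ a)    ≡⟨ sym (recipSum-+ n a (b ℕ.∸ a)) ⟩
  recipSum n (a ℕ.+ (b ℕ.∸ a))                   ≡⟨ cong (recipSum n) (ℕₚ.m+[n∸m]≡n a≤b) ⟩
  recipSum n b                                   ∎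
  where
  nonneg : ∀ d → 0ℚ ≤ℚ recipSum (n ℕ.+ a) d
  nonneg zero    = ℚₚ.≤-refl
  nonneg (suc d) = ℚₚ.+-mono-≤ (nonneg d) (0≤r (n ℕ.+ a ℕ.+ d))

-- Refining the partition increases a lower sum ...
refine-lower : ∀ c n m → recipSum (suc n) m ≤ℚ recipSum (suc c ℕ.* suc n) (suc c ℕ.* m)
refine-lower c n zero    = ℚₚ.≤-reflexive (cong (recipSum (suc c ℕ.* suc n)) (sym (ℕₚ.*-zeroʳ (suc c))))
refine-lower c n (suc m) = begin
  recipSum (suc n) m + r (suc n ℕ.+ m)
    ≡⟨ cong (λ z → recipSum (suc n) m + z) (sym (ι*r≡r c (suc n ℕ.+ m) B refl)) ⟩
  recipSum (suc n) m + ι C * r B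
    ≤⟨ ℚₚ.+-mono-≤ (refine-lower c n m) (recipSum-lower (C ℕ.* suc n ℕ.+ C ℕ.* m) C B (ℕₚ.≤-reflexive eq)) ⟩
  recipSum (C ℕ.* suc n) (C ℕ.* m) + recipSum (C ℕ.* suc n ℕ.+ C ℕ.* m) C
    ≡⟨ sym (recipSum-+ (C ℕ.* suc n) (C ℕ.* m) C) ⟩
  recipSum (C ℕ.* suc n) (C ℕ.* m ℕ.+ C)
    ≡⟨ cong (recipSum (C ℕ.* suc n)) (trans (ℕₚ.+-comm (C ℕ.* m) C) (sym (ℕₚ.*-suc C m))) ⟩
  recipSum (C ℕ.* suc n) (C ℕ.* suc m) ∎
  where
  C B : ℕ
  C = suc c
  B = (suc n ℕ.+ m) ℕ.+ c ℕ.* suc (suc n ℕ.+ m)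
  eq : C ℕ.* suc n ℕ.+ C ℕ.* m ℕ.+ C ≡ C ℕ.* suc (suc n ℕ.+ m)
  eq = trans (cong (ℕ._+ C) (sym (ℕₚ.*-distribˡ-+ C (suc n) m)))
    (trans (ℕₚ.+-comm _ C) (sym (ℕₚ.*-suc C (suc n ℕ.+ m))))

-- ... and decreases the upper sum, which exceeds the lower one by r n - r (n + m).
refine-upper : ∀ c n m →
  recipSum (suc c ℕ.* suc n) (suc c ℕ.* m) + r (n ℕ.+ m) ≤ℚ recipSum (suc n) m + r n
refine-upper c n zero = ℚₚ.≤-reflexive (cong₂ _+_
  (cong (recipSum (suc c ℕ.* suc n)) (ℕₚ.*-zeroʳ (suc c))) (cong r (ℕₚ.+-identityʳ n)))
refine-upper c n (suc m) = begin
  recipSum (C ℕ.* suc n) (C ℕ.* suc m) + r (n ℕ.+ suc m)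
    ≡⟨ cong₂ (λ y z → recipSum (C ℕ.* suc n) y + r z) (trans (ℕₚ.*-suc C m) (ℕₚ.+-comm C (C ℕ.* m))) (ℕₚ.+-suc n m) ⟩
  recipSum (C ℕ.* suc n) (C ℕ.* m ℕ.+ C) + r (suc n ℕ.+ m)
    ≡⟨ cong (_+ r (suc n ℕ.+ m)) (recipSum-+ (C ℕ.* suc n) (C ℕ.* m) C) ⟩
  recipSum (C ℕ.* suc n) (C ℕ.* m) + recipSum (C ℕ.* suc n ℕ.+ C ℕ.* m) C + r (suc n ℕ.+ m)
    ≤⟨ ℚₚ.+-monoˡ-≤ (r (suc n ℕ.+ m)) (ℚₚ.+-monoʳ-≤ (recipSum (C ℕ.* suc n) (C ℕ.* m))
         (recipSum-upper (C ℕ.* suc n ℕ.+ C ℕ.* m) C B B≤)) ⟩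
  recipSum (C ℕ.* suc n) (C ℕ.* m) + ι C * r B + r (suc n ℕ.+ m)
    ≡⟨ cong (λ z → recipSum (C ℕ.* suc n) (C ℕ.* m) + z + r (suc n ℕ.+ m)) (ι*r≡r c (n ℕ.+ m) B refl) ⟩
  recipSum (C ℕ.* suc n) (C ℕ.* m) + r (n ℕ.+ m) + r (suc n ℕ.+ m)
    ≤⟨ ℚₚ.+-monoˡ-≤ (r (suc n ℕ.+ m)) (refine-upper c n m) ⟩
  recipSum (suc n) m + r n + r (suc n ℕ.+ m)
    ≡⟨ ℚₚ.+-assoc (recipSum (suc n) m) (r n) (r (suc n ℕ.+ m)) ⟩
  recipSum (suc n) m + (r n + r (suc n ℕ.+ m))
    ≡⟨ cong (λ z → recipSum (suc n) m + z) (ℚₚ.+-comm (r n) (r (suc n ℕ.+ m))) ⟩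
  recipSum (suc n) m + (r (suc n ℕ.+ m) + r n)
    ≡⟨ sym (ℚₚ.+-assoc (recipSum (suc n) m) (r (suc n ℕ.+ m)) (r n)) ⟩
  recipSum (suc n) m + r (suc n ℕ.+ m) + r n ∎
  where
  C B : ℕ
  C = suc c
  B = (n ℕ.+ m) ℕ.+ c ℕ.* suc (n ℕ.+ m)
  B≤ : B ℕ.≤ C ℕ.* suc n ℕ.+ C ℕ.* m
  B≤ = subst (B ℕ.≤_) (ℕₚ.*-distribˡ-+ C (suc n) m) (ℕₚ.n≤1+n B)

excess-lipschitz : ∀ x y → excess x ≤ℚ excess y + ∣ x - y ∣
excess-lipschitz x y = ℚₚ.⊔-lub
  (ℚₚ.+-mono-≤ (ℚₚ.p≤p⊔q 0ℚ (y - 1ℚ)) (ℚₚ.0≤∣p∣ (x - y)))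
  (begin
    x - 1ℚ                  ≡⟨ sym ([p-q]+[q-r]≡p-r x y 1ℚ) ⟩
    (x - y) + (y - 1ℚ)      ≡⟨ ℚₚ.+-comm (x - y) (y - 1ℚ) ⟩
    (y - 1ℚ) + (x - y)      ≤⟨ ℚₚ.+-mono-≤ (ℚₚ.p≤q⊔p 0ℚ (y - 1ℚ)) (p≤∣p∣ (x - y)) ⟩
    excess y + ∣ x - y ∣    ∎)

steps-bounds : ∀ k x → ι (steps k x) ≤ℚ ι (suc k) * excess x × ι (suc k) * excess x ≤ℚ ι (steps k x) + 1ℚ
steps-bounds k x = floor-bounds (ι (suc k) * excess x)
  (subst (_≤ℚ ι (suc k) * excess x) (ℚₚ.*-zeroʳ (ι (suc k)))
    (ℚₚ.*-monoˡ-≤-nonNeg (ι (suc k)) {{ι-nonNeg (suc k)}} (ℚₚ.p≤p⊔q 0ℚ (x - 1ℚ))))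

ι-∸ : ∀ a b {t} → 0ℚ ≤ℚ t → ι a ≤ℚ ι b + t → ι (a ℕ.∸ b) ≤ℚ t
ι-∸ a b {t} 0≤t h with ℕₚ.≤-total a b
... | inj₁ a≤b = subst (λ z → ι z ≤ℚ t) (sym (ℕₚ.m≤n⇒m∸n≡0 a≤b)) 0≤t
... | inj₂ b≤a = begin
  ι (a ℕ.∸ b)                 ≡⟨ sym (q+r-q≡r (ι b) (ι (a ℕ.∸ b))) ⟩
  ι b + ι (a ℕ.∸ b) - ι b     ≡⟨ cong (_- ι b) (sym (ι-+ b (a ℕ.∸ b))) ⟩
  ι (b ℕ.+ (a ℕ.∸ b)) - ι b   ≡⟨ cong (λ z → ι z - ι b) (ℕₚ.m+[n∸m]≡n b≤a) ⟩
  ι a - ι b                   ≤⟨ p-q≤r {ι a} {ι b} {t} h ⟩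
  t                           ∎

recipSum-steps : ∀ k l x y →
  recipSum (suc k) (steps k x) ≤ℚ recipSum (suc l) (steps l y) + (∣ x - y ∣ + (r l + r l))
recipSum-steps k l x y = begin
  recipSum K m                                       ≤⟨ refine-lower l k m ⟩
  recipSum (Λ ℕ.* K) (Λ ℕ.* m)                       ≡⟨ cong (λ z → recipSum z (Λ ℕ.* m)) (ℕₚ.*-comm Λ K) ⟩
  recipSum (K ℕ.* Λ) (Λ ℕ.* m)                       ≤⟨ recipSum-mono (K ℕ.* Λ) (ℕₚ.m≤n+m∸n (Λ ℕ.* m) (K ℕ.* n)) ⟩
  recipSum (K ℕ.* Λ) (K ℕ.* n ℕ.+ d)                 ≡⟨ recipSum-+ (K ℕ.* Λ) (K ℕ.* n) d ⟩
  recipSum (K ℕ.* Λ) (K ℕ.* n) + recipSum (K ℕ.* Λ ℕ.+ K ℕ.* n) d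
    ≤⟨ ℚₚ.+-mono-≤ drop gap ⟩
  (recipSum Λ n + r l) + (r l + ∣ x - y ∣)           ≡⟨ ℚₚ.+-assoc (recipSum Λ n) (r l) _ ⟩
  recipSum Λ n + (r l + (r l + ∣ x - y ∣))           ≡⟨ cong (λ z → recipSum Λ n + z) (sym (ℚₚ.+-assoc (r l) (r l) _)) ⟩
  recipSum Λ n + (r l + r l + ∣ x - y ∣)             ≡⟨ cong (λ z → recipSum Λ n + z) (ℚₚ.+-comm (r l + r l) _) ⟩
  recipSum Λ n + (∣ x - y ∣ + (r l + r l))           ∎
  where
  K Λ m n d B : ℕ
  K = suc k
  Λ = suc l
  m = steps k x
  n = steps l y
  d = Λ ℕ.* m ℕ.∸ K ℕ.* n
  B = l ℕ.+ k ℕ.* Λ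
  T : ℚ
  T = ι K + ι (K ℕ.* Λ) * ∣ x - y ∣

  drop : recipSum (K ℕ.* Λ) (K ℕ.* n) ≤ℚ recipSum Λ n + r l
  drop = begin
    recipSum (K ℕ.* Λ) (K ℕ.* n)                  ≡⟨ sym (ℚₚ.+-identityʳ _) ⟩
    recipSum (K ℕ.* Λ) (K ℕ.* n) + 0ℚ             ≤⟨ ℚₚ.+-monoʳ-≤ (recipSum (K ℕ.* Λ) (K ℕ.* n)) (0≤r (l ℕ.+ n)) ⟩
    recipSum (K ℕ.* Λ) (K ℕ.* n) + r (l ℕ.+ n)    ≤⟨ refine-upper k l n ⟩
    recipSum Λ n + r l                            ∎

  0≤T : 0ℚ ≤ℚ T
  0≤T = ℚₚ.+-mono-≤ (ℚₚ.nonNegative⁻¹ (ι K) {{ι-nonNeg K}})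
    (ℚₚ.nonNegative⁻¹ (ι (K ℕ.* Λ) * ∣ x - y ∣)
      {{ℚₚ.nonNeg*nonNeg⇒nonNeg (ι (K ℕ.* Λ)) {{ι-nonNeg (K ℕ.* Λ)}} ∣ x - y ∣ {{ℚₚ.∣-∣-nonNeg (x - y)}}}})

  counts : ι (Λ ℕ.* m) ≤ℚ ι (K ℕ.* n) + T
  counts = begin
    ι (Λ ℕ.* m)                                      ≡⟨ ι-* Λ m ⟩
    ι Λ * ι m                                        ≤⟨ ℚₚ.*-monoˡ-≤-nonNeg (ι Λ) {{ι-nonNeg Λ}} (proj₁ (steps-bounds k x)) ⟩
    ι Λ * (ι K * excess x)                           ≡⟨ sym (ℚₚ.*-assoc (ι Λ) (ι K) (excess x)) ⟩
    ι Λ * ι K * excess x                             ≡⟨ cong (_* excess x) (ℚₚ.*-comm (ι Λ) (ι K)) ⟩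
    ι K * ι Λ * excess x                             ≡⟨ cong (_* excess x) (sym (ι-* K Λ)) ⟩
    ι (K ℕ.* Λ) * excess x                           ≤⟨ ℚₚ.*-monoˡ-≤-nonNeg (ι (K ℕ.* Λ)) {{ι-nonNeg (K ℕ.* Λ)}} (excess-lipschitz x y) ⟩
    ι (K ℕ.* Λ) * (excess y + ∣ x - y ∣)             ≡⟨ ℚₚ.*-distribˡ-+ (ι (K ℕ.* Λ)) (excess y) ∣ x - y ∣ ⟩
    ι (K ℕ.* Λ) * excess y + ι (K ℕ.* Λ) * ∣ x - y ∣
      ≡⟨ cong (λ z → z * excess y + ι (K ℕ.* Λ) * ∣ x - y ∣) (ι-* K Λ) ⟩
    ι K * ι Λ * excess y + ι (K ℕ.* Λ) * ∣ x - y ∣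
      ≡⟨ cong (_+ ι (K ℕ.* Λ) * ∣ x - y ∣) (ℚₚ.*-assoc (ι K) (ι Λ) (excess y)) ⟩
    ι K * (ι Λ * excess y) + ι (K ℕ.* Λ) * ∣ x - y ∣
      ≤⟨ ℚₚ.+-monoˡ-≤ (ι (K ℕ.* Λ) * ∣ x - y ∣) (ℚₚ.*-monoˡ-≤-nonNeg (ι K) {{ι-nonNeg K}} (proj₂ (steps-bounds l y))) ⟩
    ι K * (ι n + 1ℚ) + ι (K ℕ.* Λ) * ∣ x - y ∣
      ≡⟨ cong (_+ ι (K ℕ.* Λ) * ∣ x - y ∣) (trans (ℚₚ.*-distribˡ-+ (ι K) (ι n) 1ℚ)
           (cong₂ _+_ (sym (ι-* K n)) (ℚₚ.*-identityʳ (ι K)))) ⟩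
    ι (K ℕ.* n) + ι K + ι (K ℕ.* Λ) * ∣ x - y ∣
      ≡⟨ ℚₚ.+-assoc (ι (K ℕ.* n)) (ι K) _ ⟩
    ι (K ℕ.* n) + T                                  ∎

  gap : recipSum (K ℕ.* Λ ℕ.+ K ℕ.* n) d ≤ℚ r l + ∣ x - y ∣
  gap = begin
    recipSum (K ℕ.* Λ ℕ.+ K ℕ.* n) d
      ≤⟨ recipSum-upper (K ℕ.* Λ ℕ.+ K ℕ.* n) d B
           (ℕₚ.≤-trans (ℕₚ.n≤1+n B) (ℕₚ.m≤m+n (K ℕ.* Λ) (K ℕ.* n))) ⟩
    ι d * r B                                        ≤⟨ ℚₚ.*-monoʳ-≤-nonNeg (r B) {{r-nonNeg B}} (ι-∸ (Λ ℕ.* m) (K ℕ.* n) 0≤T counts) ⟩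
    T * r B                                          ≡⟨ ℚₚ.*-distribʳ-+ (r B) (ι K) _ ⟩
    ι K * r B + ι (K ℕ.* Λ) * ∣ x - y ∣ * r B        ≡⟨ cong₂ _+_ (ι*r≡r k l B refl) eq ⟩
    r l + ∣ x - y ∣                                  ∎
    where
    eq : ι (K ℕ.* Λ) * ∣ x - y ∣ * r B ≡ ∣ x - y ∣
    eq = trans (cong (_* r B) (ℚₚ.*-comm (ι (K ℕ.* Λ)) ∣ x - y ∣))
      (trans (ℚₚ.*-assoc ∣ x - y ∣ (ι (K ℕ.* Λ)) (r B))
      (trans (cong (∣ x - y ∣ *_) (ι*r≡1 B)) (ℚₚ.*-identityʳ ∣ x - y ∣)))

log-cauchy : (x : ℝ) → IsCauchy (logSeq (seq x))
log-cauchy x ε 0<ε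
  = N ℕ.⊔ M , λ k l hk hl →
  main k l (ℕₚ.m⊔n≤o⇒m≤o N M hk) (ℕₚ.m⊔n≤o⇒m≤o N M hl)
           (ℕₚ.m⊔n≤o⇒n≤o N M hk) (ℕₚ.m⊔n≤o⇒n≤o N M hl)
  where
  δ η : ℚ
  δ = ½ * ε
  η = ½ * δ

  0<δ : 0ℚ < δ
  0<δ = half {ε} 0<ε

  N M : ℕ
  N = proj₁ (cauchy x δ 0<δ)
  M = proj₁ (archimedean η (half {δ} 0<δ))

  y : ℕ → ℚ
  y = logSeq (seq x)

  rM<η : r M < η
  rM<η = proj₂ (archimedean η (half {δ} 0<δ)) M ℕₚ.≤-refl

  close : ∀ i j → M ℕ.≤ j → y i ≤ℚ y j + (∣ seq x i - seq x j ∣ + (r M + r M))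
  close i j M≤j = ℚₚ.≤-trans (recipSum-steps i j (seq x i) (seq x j))
    (ℚₚ.+-monoʳ-≤ (y j) (ℚₚ.+-monoʳ-≤ ∣ seq x i - seq x j ∣
      (ℚₚ.+-mono-≤ (r-mono M≤j) (r-mono M≤j))))

  main : ∀ k l → N ℕ.≤ k → N ℕ.≤ l → M ℕ.≤ k → M ℕ.≤ l → ∣ y k - y l ∣ < ε
  main k l N≤k N≤l M≤k M≤l = begin-strict
    ∣ y k - y l ∣
      ≤⟨ ∣p-q∣≤r {y k} {y l} (close k l M≤l)
           (subst (λ z → y l ≤ℚ y k + (z + (r M + r M)))
             (∣p-q∣≡∣q-p∣ (seq x l) (seq x k)) (close l k M≤k)) ⟩
    ∣ seq x k - seq x l ∣ + (r M + r M)
      <⟨ ℚₚ.+-mono-< (proj₂ (cauchy x δ 0<δ) k l N≤k N≤l) (ℚₚ.+-mono-< rM<η rM<η) ⟩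
    δ + (η + η)
      ≡⟨ cong (λ z → δ + z) (half+half δ) ⟩
    δ + δ
      ≡⟨ half+half ε ⟩
    ε ∎

log : ℝ → ℝ
log x = mkℝ (logSeq (seq x)) (log-cauchy x)

------------------------------------------------------------------------
-- Asymptotic comparison

-- The arguments form a type I, and s i is the real number that tends to
-- infinity along them.
infix 4 _≪[_]_ _≍[_]_

_≪[_]_ : {I : Set} → (I → ℝ) → (I → ℝ) → (I → ℝ) → Set
F ≪[ s ] G =
  ∃[ C ] 0ᴿ <ᴿ C × ∃[ X ] ∀ i → X ≤ᴿ s i → ∣ F i ∣ᴿ ≤ᴿ C *ᴿ G i

_≍[_]_ : {I : Set} → (I → ℝ) → (I → ℝ) → (I → ℝ) → Set
F ≍[ s ] G = F ≪[ s ] G × G ≪[ s ] F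

-- m = max { f n : n a positive integer, n ≤ x }
IsMax : (ℕ → ℕ) → ℝ → ℕ → Set
IsMax f x m =
  (∃[ n ] 1 ℕ.≤ n × fromℕ n ≤ᴿ x × f n ≡ m) ×
  (∀ n → 1 ℕ.≤ n → fromℕ n ≤ᴿ x → f n ℕ.≤ m)

-- A real x together with max_{n≤x} |L_p(n)|.  The maximum is given by its graph,
-- since the order on ℝ is undecidable and so ⌊ x ⌋ is not a computable function
-- of x; isMax-exists shows that no x ≥ 1 is excluded.
record MaxL (p : ℕ) : Set where
  field
    x      : ℝ
    max    : ℕ
    isMax  : IsMax (λ n → ℤ.∣ L p n ∣) x max

fromℕ≤⇒bounded : ∀ x → ∃[ N ] ∀ n → fromℕ n ≤ᴿ x → n ℕ.≤ N
fromℕ≤⇒bounded x with bound x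
... | B , 0<B , M , h = N , main
  where
  B′ : ℚ
  B′ = B + 1ℚ
  N : ℕ
  N = ℤ.∣ floor B′ ∣ ℕ.+ 1
  0≤B′ : 0ℚ ≤ℚ B′
  0≤B′ = ℚₚ.+-mono-≤ (ℚₚ.<⇒≤ 0<B) (ℚₚ.nonNegative⁻¹ 1ℚ)
  B′≤N : B′ ≤ℚ ι N
  B′≤N = subst (B′ ≤ℚ_) (sym (ι-+ ℤ.∣ floor B′ ∣ 1)) (proj₂ (floor-bounds B′ 0≤B′))
  ι-cancel : ∀ n → ι n ≤ℚ ι N → n ℕ.≤ N
  ι-cancel n e with n ℕₚ.≤? N
  ... | yes n≤N = n≤N
  ... | no  n≰N = ⊥-elim (ℚₚ.<-irrefl {ι N} {ι N} refl (begin-strict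
    ι N          ≡⟨ sym (ℚₚ.+-identityʳ (ι N)) ⟩
    ι N + 0ℚ     <⟨ ℚₚ.+-monoʳ-< (ι N) {0ℚ} {1ℚ} (ℚₚ.positive⁻¹ 1ℚ) ⟩
    ι N + 1ℚ     ≡⟨ sym (ι-+ N 1) ⟩
    ι (N ℕ.+ 1)  ≤⟨ ι-mono (subst (ℕ._≤ n) (ℕₚ.+-comm 1 N) (ℕₚ.≰⇒> n≰N)) ⟩
    ι n          ≤⟨ e ⟩
    ι N          ∎))
  main : ∀ n → fromℕ n ≤ᴿ x → n ℕ.≤ N
  main n le with le 1ℚ (ℚₚ.positive⁻¹ 1ℚ)
  ... | K , g = ι-cancel n (begin
    ι n                       ≤⟨ g (M ℕ.⊔ K) (ℕₚ.m≤n⊔m M K) ⟩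
    seq x (M ℕ.⊔ K) + 1ℚ      ≤⟨ ℚₚ.+-monoˡ-≤ 1ℚ (ℚₚ.≤-trans (p≤∣p∣ (seq x (M ℕ.⊔ K))) (h (M ℕ.⊔ K) (ℕₚ.m≤m⊔n M K))) ⟩
    B′                        ≤⟨ B′≤N ⟩
    ι N                       ∎)

¬¬max-upTo : (P : ℕ → Set) (f : ℕ → ℕ) → P 1 → ∀ N →
  ¬ ¬ (∃[ m ] (∃[ n ] 1 ℕ.≤ n × P n × f n ≡ m) × (∀ n → 1 ℕ.≤ n → n ℕ.≤ N → P n → f n ℕ.≤ m))
¬¬max-upTo P f P1 zero k = k (f 1 , (1 , ℕₚ.≤-refl , P1 , refl) ,
  λ n 1≤n n≤0 _ → ⊥-elim (ℕₚ.<-irrefl refl (ℕₚ.≤-trans 1≤n n≤0)))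
¬¬max-upTo P f P1 (suc N) k = ¬¬max-upTo P f P1 N λ (m , (n₀ , 1≤n₀ , Pn₀ , e₀) , bd) →
  let
    M : ℕ
    M = m ℕ.⊔ f (suc N)

    split : ∀ {a} → (P (suc N) → f (suc N) ℕ.≤ a) → m ℕ.≤ a →
            ∀ n → 1 ℕ.≤ n → n ℕ.≤ suc N → P n → f n ℕ.≤ a
    split {a} top m≤a n 1≤n n≤1+N Pn =
      [ (λ n<1+N → ℕₚ.≤-trans (bd n 1≤n (ℕₚ.≤-pred n<1+N) Pn) m≤a)
      , (λ e → subst (λ z → f z ℕ.≤ a) (sym e) (top (subst P e Pn)))
      ]′ (ℕₚ.m≤n⇒m<n∨m≡n n≤1+N)
  in
  ¬¬-excluded-middle {A = P (suc N)} λ where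
    (no ¬P) → k (m , (n₀ , 1≤n₀ , Pn₀ , e₀) , split (λ P′ → ⊥-elim (¬P P′)) ℕₚ.≤-refl)
    (yes P′) → k (M
      , [ (λ e → n₀ , 1≤n₀ , Pn₀ , trans e₀ (sym e))
        , (λ e → suc N , ℕ.s≤s ℕ.z≤n , P′ , sym e) ]′ (ℕₚ.⊔-sel m (f (suc N)))
      , split (λ _ → ℕₚ.m≤n⊔m m (f (suc N))) (ℕₚ.m≤m⊔n m (f (suc N))))

isMax-exists : ∀ f x → fromℕ 1 ≤ᴿ x → ¬ ¬ (∃[ m ] IsMax f x m)
isMax-exists f x 1≤x refute =
  let N , bounded = fromℕ≤⇒bounded x in
  ¬¬max-upTo (λ n → fromℕ n ≤ᴿ x) f 1≤x N λ (m , att , bd) →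
    refute (m , att , λ n 1≤n n≤x → bd n 1≤n (bounded n n≤x) n≤x)

{-# OPTIONS --safe #-}

-- With χ the Legendre symbol modulo p, λ_p agrees with χ at integers prime to p, and
-- λ_p(p n) = λ_p(n).  As χ sums to zero over a period, this gives
--   L_p(p q + d) = L_p(q) + χ(1) + ... + χ(d)   for 0 ≤ d < p,
-- so that L_p(n) is a sum over the base-p digits of n of terms bounded by p.  It equals k
-- when n = 1 + p + ... + p^(k-1), where each of the k digits contributes χ(1) = 1.
-- The zero sum and the multiplicativity of χ come from counting the solutions of y² ≡ n x.
module Submission where

open import Data.Bool.Base using (if_then_else_)
open import Data.Nat.Base as ℕ using (ℕ; zero; suc; NonZero; _%_; z≤n; s≤s)
import Data.Nat.Properties as ℕₚ
open import Data.Nat.Divisibility using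
  ( _∣_; _∣?_; divides; _∣0; ∣1⇒≡1; ∣⇒≤; ∣-reflexive; m∣m*n; n∣m*n; ∣m⇒∣m*n; ∣n⇒∣m*n
  ; m%n≡0⇒n∣m; n∣m⇒m%n≡0)
open import Data.Nat.DivMod
open import Data.Nat.Coprimality using (Coprime; coprime-Bézout)
open import Data.Nat.GCD using (module Bézout)
open import Data.Nat.ListAction using (product)
open import Data.Nat.Primality
  using (Prime; euclidsLemma; prime⇒nonZero; prime⇒nonTrivial; prime⇒irreducible; ¬prime[0])
open import Data.Nat.Primality.Factorisation using (PrimeFactorisation; factors; factorise)
import Data.Nat.Tactic.RingSolver as ℕ-Solver
open import Data.Integer.Base as ℤ using (ℤ; +_; 0ℤ; 1ℤ; -1ℤ; ∣_∣)
import Data.Integer.Properties as ℤₚ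
open import Data.Rational.Base as ℚ using (ℚ; floor) renaming (_≤_ to _≤ℚ_)
import Data.Rational.Properties as ℚₚ
import Data.Rational.Unnormalised.Properties as ℚᵘₚ
open import Algebra.Bundles using (CommutativeMonoid)
open import Algebra.Properties.AbelianGroup ℤₚ.+-0-abelianGroup using (identityʳ-unique; inverseʳ-unique)
open import Algebra.Properties.CommutativeSemigroup ℤₚ.+-commutativeSemigroup using (interchange)
open import Algebra.Properties.CommutativeSemigroup
  (CommutativeMonoid.commutativeSemigroup ℚₚ.*-1-commutativeMonoid) using (x∙yz≈y∙xz)
open import Data.Fin.Base using (toℕ; fromℕ<)
open import Data.Fin.Properties using (toℕ-fromℕ<)
open import Data.List.Base using ([]; _∷_; map)
open import Data.Product.Base using (∃-syntax; _×_; _,_; proj₁; proj₂)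
open import Data.Sum.Base using (_⊎_; inj₁; inj₂; [_,_]′)
open import Function.Base using (_∘_; id)
open import Relation.Nullary using (Dec; yes; no; ¬_; does; contradiction)
open import Relation.Nullary.Decidable using (dec-true; dec-false)
open import Relation.Binary.PropositionalEquality
open import Defs using
  ( IsSquareMod; isSquareMod?; legendre; lambdaAtPrime; productℤ; lambda; lambda-prime; lambda-*; L
  ; seq; cauchy; _≤ᴿ_; _<ᴿ_; fromℕ; 0ᴿ; ∣_∣ᴿ; _*ᴿ_; q+r-q≡r; p-q≤r; p≤q+∣p-q∣
  ; recipSum; excess; steps; log; ι; r; toℚᵘ-/; ι-+; ι-*; ι-mono; ι-nonNeg; r-nonNeg; ι*r≡1; ι*r≡r
  ; floor-bounds; recipSum-+; ι-suc-*; recipSum-lower; recipSum-upper; recipSum-mono; steps-bounds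
  ; _≪[_]_; _≍[_]_; MaxL)

-- Finite sums of integers

-- `legendre` is decided by a search for a root, so the hard case of multiplicativity is a product
-- of two nonresidues, for which no root can be written down; the vanishing sum forces its value. On
-- the analytic side `log` is a limit of Riemann sums attached to a Cauchy sequence, and every
-- comparison is made term by term along that sequence. There `log (p^k)` is needed only up to
-- factors depending on `p`: the crude bounds `k / p` and `k (p - 1)` suffice. What has to be
-- controlled is slack: `≤ᴿ` and `cauchy` locate a real only up to an error and no floor of it is
-- computable, so the powers of `p` below and above `x` are allowed to lie a bounded number of
-- exponents apart, and the implied constants absorb the difference.

module _ where

  open import Data.Integer.Base using (_+_; _≤_)

  ∑< : ℕ → (ℕ → ℤ) → ℤ
  ∑< zero    f = 0ℤ
  ∑< (suc n) f = ∑< n f + f n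

  ∑<-cong : ∀ n {f g} → (∀ {i} → i ℕ.< n → f i ≡ g i) → ∑< n f ≡ ∑< n g
  ∑<-cong zero    eq = refl
  ∑<-cong (suc n) eq = cong₂ _+_ (∑<-cong n (eq ∘ ℕₚ.m<n⇒m<1+n)) (eq ℕₚ.≤-refl)

  ∑<-zero : ∀ n → ∑< n (λ _ → 0ℤ) ≡ 0ℤ
  ∑<-zero zero    = refl
  ∑<-zero (suc n) = trans (ℤₚ.+-identityʳ _) (∑<-zero n)

  ∑<-+ : ∀ n f g → ∑< n (λ i → f i + g i) ≡ ∑< n f + ∑< n g
  ∑<-+ zero    f g = refl
  ∑<-+ (suc n) f g = trans (cong (_+ (f n + g n)) (∑<-+ n f g)) (interchange (∑< n f) (∑< n g) (f n) (g n))

  ∑<-comm : ∀ m n (f : ℕ → ℕ → ℤ) → ∑< m (λ i → ∑< n (f i)) ≡ ∑< n (λ j → ∑< m (λ i → f i j))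
  ∑<-comm zero    n f = sym (∑<-zero n)
  ∑<-comm (suc m) n f = trans (cong (_+ ∑< n (f m)) (∑<-comm m n f)) (sym (∑<-+ n _ _))

  ∑<-nonPos : ∀ n {f} → (∀ i → f i ≤ 0ℤ) → ∑< n f ≤ 0ℤ
  ∑<-nonPos zero    f≤0 = ℤₚ.≤-refl
  ∑<-nonPos (suc n) f≤0 = ℤₚ.+-mono-≤ (∑<-nonPos n f≤0) (f≤0 n)

  i+j≡0∧j≤0⇒0≤i : ∀ {i j} → i + j ≡ 0ℤ → j ≤ 0ℤ → 0ℤ ≤ i
  i+j≡0∧j≤0⇒0≤i {i} {j} eq j≤0 = subst₂ _≤_ eq (ℤₚ.+-identityʳ i) (ℤₚ.+-monoʳ-≤ i j≤0)

  ∑<-nonPos-≡0 : ∀ n {f} → (∀ i → f i ≤ 0ℤ) → ∑< n f ≡ 0ℤ → ∀ {i} → i ℕ.< n → f i ≡ 0ℤ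
  ∑<-nonPos-≡0 (suc n) {f} f≤0 eq i<1+n with ℕₚ.m<1+n⇒m<n∨m≡n i<1+n
  ... | inj₁ i<n  = ∑<-nonPos-≡0 n f≤0
    (ℤₚ.≤-antisym (∑<-nonPos n f≤0) (i+j≡0∧j≤0⇒0≤i eq (f≤0 n))) i<n
  ... | inj₂ refl = ℤₚ.≤-antisym (f≤0 n)
    (i+j≡0∧j≤0⇒0≤i (trans (ℤₚ.+-comm (f n) _) eq) (∑<-nonPos n f≤0))

  𝟙 : ∀ {A : Set} → Dec A → ℤ
  𝟙 A? = if does A? then 1ℤ else 0ℤ

  𝟙-true : ∀ {A : Set} (A? : Dec A) → A → 𝟙 A? ≡ 1ℤ
  𝟙-true A? a = cong (if_then 1ℤ else 0ℤ) (dec-true A? a)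

  𝟙-false : ∀ {A : Set} (A? : Dec A) → ¬ A → 𝟙 A? ≡ 0ℤ
  𝟙-false A? ¬a = cong (if_then 1ℤ else 0ℤ) (dec-false A? ¬a)

  𝟙-cong : ∀ {A B : Set} (A? : Dec A) (B? : Dec B) → (A → B) → (B → A) → 𝟙 A? ≡ 𝟙 B?
  𝟙-cong A? (yes b) f g = 𝟙-true A? (g b)
  𝟙-cong A? (no ¬b) f g = 𝟙-false A? (¬b ∘ f)

  ∑<-none : ∀ n {P : ℕ → Set} (P? : ∀ i → Dec (P i)) → (∀ i → ¬ P i) → ∑< n (𝟙 ∘ P?) ≡ 0ℤ
  ∑<-none n P? ¬P = trans (∑<-cong n λ {i} _ → 𝟙-false (P? i) (¬P i)) (∑<-zero n)

  ∑<-δ : ∀ n {a} → a ℕ.< n → ∑< n (λ i → 𝟙 (i ℕₚ.≟ a)) ≡ 1ℤ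
  ∑<-δ (suc n) {a} a<1+n with ℕₚ.m<1+n⇒m<n∨m≡n a<1+n
  ... | inj₁ a<n  = cong₂ _+_ (∑<-δ n a<n) (𝟙-false (n ℕₚ.≟ a) (ℕₚ.<⇒≢ a<n ∘ sym))
  ... | inj₂ refl = cong₂ _+_
    (trans (∑<-cong n λ {i} i<n → 𝟙-false (i ℕₚ.≟ n) (ℕₚ.<⇒≢ i<n)) (∑<-zero n))
    (𝟙-true (n ℕₚ.≟ n) refl)

  ∑<-one : ∀ n {P : ℕ → Set} (P? : ∀ i → Dec (P i)) {a} → a ℕ.< n → P a →
           (∀ {i} → i ℕ.< n → P i → i ≡ a) → ∑< n (𝟙 ∘ P?) ≡ 1ℤ
  ∑<-one n {P} P? {a} a<n Pa unique = trans
    (∑<-cong n λ {i} i<n → 𝟙-cong (P? i) (i ℕₚ.≟ a) (unique i<n) (λ i≡a → subst P (sym i≡a) Pa))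
    (∑<-δ n a<n)

  ∑<-two : ∀ n {P : ℕ → Set} (P? : ∀ i → Dec (P i)) {a b} → a ℕ.< n → b ℕ.< n → a ≢ b → P a → P b →
           (∀ {i} → i ℕ.< n → P i → i ≡ a ⊎ i ≡ b) → ∑< n (𝟙 ∘ P?) ≡ 1ℤ + 1ℤ
  ∑<-two n {P} P? {a} {b} a<n b<n a≢b Pa Pb only = trans (∑<-cong n split)
    (trans (∑<-+ n _ _) (cong₂ _+_ (∑<-δ n a<n) (∑<-δ n b<n)))
    where
    split : ∀ {i} → i ℕ.< n → 𝟙 (P? i) ≡ 𝟙 (i ℕₚ.≟ a) + 𝟙 (i ℕₚ.≟ b)
    split {i} i<n with i ℕₚ.≟ a | i ℕₚ.≟ b
    ... | yes i≡a | yes i≡b = contradiction (trans (sym i≡a) i≡b) a≢b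
    ... | yes i≡a | no  i≢b = trans (𝟙-true (P? i) (subst P (sym i≡a) Pa))
      (sym (cong₂ _+_ (𝟙-true (i ℕₚ.≟ a) i≡a) (𝟙-false (i ℕₚ.≟ b) i≢b)))
    ... | no  i≢a | yes i≡b = trans (𝟙-true (P? i) (subst P (sym i≡b) Pb))
      (sym (cong₂ _+_ (𝟙-false (i ℕₚ.≟ a) i≢a) (𝟙-true (i ℕₚ.≟ b) i≡b)))
    ... | no  i≢a | no  i≢b = trans (𝟙-false (P? i) ([ i≢a , i≢b ]′ ∘ only i<n))
      (sym (cong₂ _+_ (𝟙-false (i ℕₚ.≟ a) i≢a) (𝟙-false (i ℕₚ.≟ b) i≢b)))

-- Congruences and the Legendre symbol

∣m²-n²∣ : ∀ m n → ℕ.∣ m ℕ.* m - n ℕ.* n ∣ ≡ (m ℕ.+ n) ℕ.* ℕ.∣ m - n ∣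
∣m²-n²∣ m n = sym (begin
  (m ℕ.+ n) ℕ.* ℕ.∣ m - n ∣                           ≡⟨ ℕₚ.*-distribˡ-∣-∣ (m ℕ.+ n) m n ⟩
  ℕ.∣ (m ℕ.+ n) ℕ.* m - (m ℕ.+ n) ℕ.* n ∣             ≡⟨ cong₂ ℕ.∣_-_∣ (expandˡ m n) (ℕₚ.*-distribʳ-+ n m n) ⟩
  ℕ.∣ m ℕ.* n ℕ.+ m ℕ.* m - m ℕ.* n ℕ.+ n ℕ.* n ∣     ≡⟨ ℕₚ.∣m+n-m+o∣≡∣n-o∣ (m ℕ.* n) _ _ ⟩
  ℕ.∣ m ℕ.* m - n ℕ.* n ∣                             ∎)
  where
  open ≡-Reasoning
  expandˡ : ∀ m n → (m ℕ.+ n) ℕ.* m ≡ m ℕ.* n ℕ.+ m ℕ.* m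
  expandˡ = ℕ-Solver.solve-∀

module Congruence (p : ℕ) .{{_ : NonZero p}} where

  infix 4 _≈_

  -- Equality of remainders is decidable and chains in equational reasoning. `∣-∣⇒≈` and `≈⇒∣-∣`
  -- translate it to divisibility of an absolute difference, the form used by `IsSquareMod` and by
  -- Euclid's lemma.
  _≈_ : ℕ → ℕ → Set
  a ≈ b = a % p ≡ b % p

  ≈-%ˡ : ∀ a → a % p ≈ a
  ≈-%ˡ a = m%n%n≡m%n a p

  *-cong-≈ : ∀ {a b c d} → a ≈ b → c ≈ d → a ℕ.* c ≈ b ℕ.* d
  *-cong-≈ {a} {b} {c} {d} a≈b c≈d = begin
    (a ℕ.* c) % p                  ≡⟨ %-distribˡ-* a c p ⟩
    ((a % p) ℕ.* (c % p)) % p      ≡⟨ cong (_% p) (cong₂ ℕ._*_ a≈b c≈d) ⟩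
    ((b % p) ℕ.* (d % p)) % p      ≡⟨ %-distribˡ-* b d p ⟨
    (b ℕ.* d) % p                  ∎
    where open ≡-Reasoning

  ∣-resp-≈ : ∀ {a b} → a ≈ b → p ∣ a → p ∣ b
  ∣-resp-≈ {a} {b} a≈b p∣a = m%n≡0⇒n∣m b p (trans (sym a≈b) (n∣m⇒m%n≡0 a p p∣a))

  ∣⇒≈0 : ∀ {a} → p ∣ a → a ≈ 0
  ∣⇒≈0 {a} p∣a = trans (n∣m⇒m%n≡0 a p p∣a) (sym (m<n⇒m%n≡m (ℕ.>-nonZero⁻¹ p)))

  ≈⇒≡ : ∀ {a b} → a ℕ.< p → b ℕ.< p → a ≈ b → a ≡ b
  ≈⇒≡ a<p b<p a≈b = trans (sym (m<n⇒m%n≡m a<p)) (trans a≈b (m<n⇒m%n≡m b<p))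

  private
    ≤∧∣⇒≈ : ∀ {a b} → a ℕ.≤ b → p ∣ ℕ.∣ a - b ∣ → a ≈ b
    ≤∧∣⇒≈ {a} {b} a≤b p∣ = sym (begin
      b % p                    ≡⟨ cong (_% p) (ℕₚ.m+[n∸m]≡n a≤b) ⟨
      (a ℕ.+ (b ℕ.∸ a)) % p    ≡⟨ %-remove-+ʳ a (subst (p ∣_) (ℕₚ.m≤n⇒∣m-n∣≡n∸m a≤b) p∣) ⟩
      a % p                    ∎)
      where open ≡-Reasoning

  ∣-∣⇒≈ : ∀ {a b} → p ∣ ℕ.∣ a - b ∣ → a ≈ b
  ∣-∣⇒≈ {a} {b} p∣ with ℕₚ.≤-total a b
  ... | inj₁ a≤b = ≤∧∣⇒≈ a≤b p∣
  ... | inj₂ b≤a = sym (≤∧∣⇒≈ b≤a (subst (p ∣_) (ℕₚ.∣-∣-comm a b) p∣))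

  ≈⇒∣-∣ : ∀ {a b} → a ≈ b → p ∣ ℕ.∣ a - b ∣
  ≈⇒∣-∣ {a} {b} a≈b = subst (p ∣_) (sym (begin
    ℕ.∣ a - b ∣
      ≡⟨ cong₂ ℕ.∣_-_∣ (m≡m%n+[m/n]*n a p) (trans (m≡m%n+[m/n]*n b p) (cong (ℕ._+ _) (sym a≈b))) ⟩
    ℕ.∣ (a % p ℕ.+ a ℕ./ p ℕ.* p) - (a % p ℕ.+ b ℕ./ p ℕ.* p) ∣
      ≡⟨ ℕₚ.∣m+n-m+o∣≡∣n-o∣ (a % p) _ _ ⟩
    ℕ.∣ a ℕ./ p ℕ.* p - b ℕ./ p ℕ.* p ∣
      ≡⟨ ℕₚ.*-distribʳ-∣-∣ p (a ℕ./ p) (b ℕ./ p) ⟨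
    ℕ.∣ a ℕ./ p - b ℕ./ p ∣ ℕ.* p ∎)) (n∣m*n ℕ.∣ a ℕ./ p - b ℕ./ p ∣)
    where open ≡-Reasoning

module OddPrime {p : ℕ} (p-prime : Prime p) (2∤p : ¬ (2 ∣ p)) where

  instance
    p≢0 : NonZero p
    p≢0 = prime⇒nonZero p-prime

  open Congruence p
  open import Data.Integer.Base using (_+_; _*_; -_; _≤_)

  *-cancelˡ-≈ : ∀ {n a b} → ¬ (p ∣ n) → n ℕ.* a ≈ n ℕ.* b → a ≈ b
  *-cancelˡ-≈ {n} {a} {b} p∤n na≈nb
    with euclidsLemma n ℕ.∣ a - b ∣ p-prime (subst (p ∣_) (sym (ℕₚ.*-distribˡ-∣-∣ n a b)) (≈⇒∣-∣ na≈nb))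
  ... | inj₁ p∣n = contradiction p∣n p∤n
  ... | inj₂ p∣  = ∣-∣⇒≈ p∣

  p∤n⇒coprime : ∀ {n} → ¬ (p ∣ n) → Coprime p n
  p∤n⇒coprime p∤n (d∣p , d∣n) with prime⇒irreducible p-prime d∣p
  ... | inj₁ d≡1  = d≡1
  ... | inj₂ refl = contradiction d∣n p∤n

  inverse : ∀ {n} → ¬ (p ∣ n) → ∃[ m ] n ℕ.* m ≈ 1
  inverse {n} p∤n with coprime-Bézout (p∤n⇒coprime p∤n)
  ... | Bézout.-+ x y eq = y , (begin
    (n ℕ.* y) % p          ≡⟨ cong (_% p) (trans (ℕₚ.*-comm n y) (sym eq)) ⟩
    (1 ℕ.+ x ℕ.* p) % p    ≡⟨ [m+kn]%n≡m%n 1 x p ⟩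
    1 % p                  ∎)
    where open ≡-Reasoning
  -- Here `1 + y n = x p`, so `y` inverts `n` only up to sign; the factor `pred p`, which is `-1`
  -- modulo `p`, corrects the sign.
  ... | Bézout.+- x y eq = ℕ.pred p ℕ.* y , (begin
    (n ℕ.* (ℕ.pred p ℕ.* y)) % p                        ≡⟨ [m+kn]%n≡m%n _ x p ⟨
    (n ℕ.* (ℕ.pred p ℕ.* y) ℕ.+ x ℕ.* p) % p            ≡⟨ cong (λ z → (n ℕ.* (ℕ.pred p ℕ.* y) ℕ.+ z) % p) eq ⟨
    (n ℕ.* (ℕ.pred p ℕ.* y) ℕ.+ (1 ℕ.+ y ℕ.* n)) % p    ≡⟨ cong (_% p) (lemma n (ℕ.pred p) y) ⟩
    (1 ℕ.+ n ℕ.* y ℕ.* suc (ℕ.pred p)) % p              ≡⟨ cong (λ z → (1 ℕ.+ n ℕ.* y ℕ.* z) % p) (ℕₚ.suc-pred p) ⟩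
    (1 ℕ.+ n ℕ.* y ℕ.* p) % p                           ≡⟨ [m+kn]%n≡m%n 1 (n ℕ.* y) p ⟩
    1 % p                                               ∎)
    where
    open ≡-Reasoning
    lemma : ∀ a b c → a ℕ.* (b ℕ.* c) ℕ.+ (1 ℕ.+ c ℕ.* a) ≡ 1 ℕ.+ a ℕ.* c ℕ.* suc b
    lemma = ℕ-Solver.solve-∀

  -- The root is not confined to `Fin p`, so roots can be multiplied without reduction.
  Square : ℕ → Set
  Square a = ∃[ x ] x ℕ.* x ≈ a

  square⇒isSquareMod : ∀ {a} → Square a → IsSquareMod p a
  square⇒isSquareMod {a} (x , x²≈a) = fromℕ< x%p<p , ≈⇒∣-∣ (begin
    (toℕ (fromℕ< x%p<p) ℕ.* toℕ (fromℕ< x%p<p)) % p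
      ≡⟨ cong (λ y → (y ℕ.* y) % p) (toℕ-fromℕ< x%p<p) ⟩
    ((x % p) ℕ.* (x % p)) % p    ≡⟨ *-cong-≈ (≈-%ˡ x) (≈-%ˡ x) ⟩
    (x ℕ.* x) % p                ≡⟨ x²≈a ⟩
    a % p                        ∎)
    where
    open ≡-Reasoning
    x%p<p = m%n<n x p

  isSquareMod⇒square : ∀ {a} → IsSquareMod p a → Square a
  isSquareMod⇒square (x , p∣) = toℕ x , ∣-∣⇒≈ p∣

  Square-resp-≈ : ∀ {a b} → a ≈ b → Square a → Square b
  Square-resp-≈ a≈b (x , x²≈a) = x , trans x²≈a a≈b

  Square-* : ∀ {a b} → Square a → Square b → Square (a ℕ.* b)
  Square-* (x , x²≈a) (y , y²≈b) = x ℕ.* y ,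
    trans (cong (_% p) (ℕₚ.[m*n]*[o*p]≡[m*o]*[n*p] x y x y)) (*-cong-≈ x²≈a y²≈b)

  -- From `a = x²` and `a b = z²` the root of `b` is `z / x`. Multiplying the claim by `a` turns it
  -- into `(x x′)² z² ≈ a b`, where `x x′ ≈ 1`.
  Square-cancelˡ : ∀ {a b} → ¬ (p ∣ a) → Square a → Square (a ℕ.* b) → Square b
  Square-cancelˡ {a} {b} p∤a (x , x²≈a) (z , z²≈ab) = x′ ℕ.* z , *-cancelˡ-≈ p∤a (begin
    (a ℕ.* (x′ ℕ.* z ℕ.* (x′ ℕ.* z))) % p              ≡⟨ *-cong-≈ (sym x²≈a) refl ⟩
    (x ℕ.* x ℕ.* (x′ ℕ.* z ℕ.* (x′ ℕ.* z))) % p        ≡⟨ cong (_% p) (lemma x x′ z) ⟩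
    ((x ℕ.* x′) ℕ.* (x ℕ.* x′) ℕ.* (z ℕ.* z)) % p      ≡⟨ *-cong-≈ {c = z ℕ.* z} (*-cong-≈ xx′≈1 xx′≈1) z²≈ab ⟩
    (1 ℕ.* (a ℕ.* b)) % p                              ≡⟨ cong (_% p) (ℕₚ.*-identityˡ (a ℕ.* b)) ⟩
    (a ℕ.* b) % p                                      ∎)
    where
    open ≡-Reasoning
    p∤x : ¬ (p ∣ x)
    p∤x p∣x = p∤a (∣-resp-≈ x²≈a (∣m⇒∣m*n x p∣x))
    x′ = proj₁ (inverse p∤x)
    xx′≈1 = proj₂ (inverse p∤x)
    lemma : ∀ x y z → x ℕ.* x ℕ.* (y ℕ.* z ℕ.* (y ℕ.* z)) ≡ (x ℕ.* y) ℕ.* (x ℕ.* y) ℕ.* (z ℕ.* z)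
    lemma = ℕ-Solver.solve-∀

  χ : ℕ → ℤ
  χ a = legendre a p

  -- Indexed by the value of the symbol: matching on `χ a` together with `χ-view a` replaces the
  -- symbol by a number and supplies the evidence. Since the cases exclude each other, `χ≡` recovers
  -- the value from the evidence.
  data LegendreView (a : ℕ) : ℤ → Set where
    zero       : p ∣ a → LegendreView a 0ℤ
    residue    : ¬ (p ∣ a) → Square a → LegendreView a 1ℤ
    nonresidue : ¬ (p ∣ a) → ¬ Square a → LegendreView a -1ℤ

  χ-view : ∀ a → LegendreView a (χ a)
  χ-view a with p ∣? a | isSquareMod? p a
  ... | yes p∣a | _      = zero p∣a
  ... | no  p∤a | yes sq = residue p∤a (isSquareMod⇒square sq)
  ... | no  p∤a | no ¬sq = nonresidue p∤a (¬sq ∘ square⇒isSquareMod)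

  χ≡ : ∀ {a i} → LegendreView a i → χ a ≡ i
  χ≡ {a} v = unique (χ-view a) v
    where
    unique : ∀ {i j} → LegendreView a i → LegendreView a j → i ≡ j
    unique (zero _)           (zero _)           = refl
    unique (zero p∣a)         (residue p∤a _)    = contradiction p∣a p∤a
    unique (zero p∣a)         (nonresidue p∤a _) = contradiction p∣a p∤a
    unique (residue p∤a _)    (zero p∣a)         = contradiction p∣a p∤a
    unique (residue _ _)      (residue _ _)      = refl
    unique (residue _ sq)     (nonresidue _ ¬sq) = contradiction sq ¬sq
    unique (nonresidue p∤a _) (zero p∣a)         = contradiction p∣a p∤a
    unique (nonresidue _ ¬sq) (residue _ sq)     = contradiction sq ¬sq
    unique (nonresidue _ _)   (nonresidue _ _)   = refl

  χ-cong : ∀ {a b} → a ≈ b → χ a ≡ χ b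
  χ-cong {a} {b} a≈b with χ b | χ-view b
  ... | _ | zero p∣b           = χ≡ (zero (∣-resp-≈ (sym a≈b) p∣b))
  ... | _ | residue p∤b sq     = χ≡ (residue (p∤b ∘ ∣-resp-≈ a≈b) (Square-resp-≈ (sym a≈b) sq))
  ... | _ | nonresidue p∤b ¬sq = χ≡ (nonresidue (p∤b ∘ ∣-resp-≈ a≈b) (¬sq ∘ Square-resp-≈ a≈b))

  χ[0]≡0 : χ 0 ≡ 0ℤ
  χ[0]≡0 = χ≡ (zero (p ∣0))

  p∤1 : ¬ (p ∣ 1)
  p∤1 p∣1 = ℕₚ.<⇒≢ (ℕ.nonTrivial⇒n>1 p {{prime⇒nonTrivial p-prime}}) (sym (∣1⇒≡1 p∣1))

  χ[1]≡1 : χ 1 ≡ 1ℤ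
  χ[1]≡1 = χ≡ (residue p∤1 (1 , refl))

  ∣χ∣≤1 : ∀ a → ∣ χ a ∣ ℕ.≤ 1
  ∣χ∣≤1 a with χ a | χ-view a
  ... | _ | zero _         = z≤n
  ... | _ | residue _ _    = ℕₚ.≤-refl
  ... | _ | nonresidue _ _ = ℕₚ.≤-refl

  -- Counting square roots, and multiplicativity of the Legendre symbol

  infix 4 _≈?_

  _≈?_ : ∀ a b → Dec (a ≈ b)
  a ≈? b = a % p ℕₚ.≟ b % p

  squareRoots : ∀ {x y} → x ℕ.< p → y ℕ.< p → y ℕ.* y ≈ x ℕ.* x → y ≡ x ⊎ y ≡ p ℕ.∸ x
  squareRoots {x} {y} x<p y<p y²≈x²
    with euclidsLemma (y ℕ.+ x) ℕ.∣ y - x ∣ p-prime (subst (p ∣_) (∣m²-n²∣ y x) (≈⇒∣-∣ y²≈x²))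
  ... | inj₂ p∣y-x = inj₁ (≈⇒≡ y<p x<p (∣-∣⇒≈ p∣y-x))
  -- `y + x` is a multiple of `p` below `2 p`: quotient 0 means `x = y = 0`, quotient 1 gives the
  -- opposite root.
  ... | inj₁ (divides zero y+x≡0) =
    inj₁ (trans (ℕₚ.m+n≡0⇒m≡0 y y+x≡0) (sym (ℕₚ.m+n≡0⇒n≡0 y y+x≡0)))
  ... | inj₁ (divides (suc zero) y+x≡p) =
    inj₂ (trans (sym (ℕₚ.m+n∸n≡m y x)) (cong (ℕ._∸ x) (trans y+x≡p (ℕₚ.*-identityˡ p))))
  ... | inj₁ (divides (suc (suc k)) y+x≡) = contradiction
    (subst (ℕ._< p ℕ.+ p) y+x≡ (ℕₚ.+-mono-< y<p x<p))
    (ℕₚ.≤⇒≯ (ℕₚ.+-monoʳ-≤ p (ℕₚ.m≤m+n p (k ℕ.* p))))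

  [p∸x]²≈x² : ∀ {x} → x ℕ.≤ p → (p ℕ.∸ x) ℕ.* (p ℕ.∸ x) ≈ x ℕ.* x
  [p∸x]²≈x² {x} x≤p = ∣-∣⇒≈ (subst (p ∣_) (sym (∣m²-n²∣ (p ℕ.∸ x) x))
    (∣m⇒∣m*n ℕ.∣ p ℕ.∸ x - x ∣ (∣-reflexive (sym (ℕₚ.m∸n+n≡m x≤p)))))

  rootCount : ∀ a → ∑< p (λ y → 𝟙 (y ℕ.* y ≈? a)) ≡ 1ℤ + χ a
  rootCount a with χ a | χ-view a
  ... | _ | zero p∣a = ∑<-one p (λ y → y ℕ.* y ≈? a) 0<p (sym (∣⇒≈0 p∣a))
    λ {y} y<p y²≈a → ≈⇒≡ y<p 0<p (∣⇒≈0 (∣y²⇒∣y y (∣-resp-≈ (sym y²≈a) p∣a)))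
    where
    0<p = ℕ.>-nonZero⁻¹ p
    ∣y²⇒∣y : ∀ y → p ∣ y ℕ.* y → p ∣ y
    ∣y²⇒∣y y = [ id , id ]′ ∘ euclidsLemma y y p-prime
  ... | _ | nonresidue p∤a ¬sq = ∑<-none p (λ y → y ℕ.* y ≈? a) λ y y²≈a → ¬sq (y , y²≈a)
  ... | _ | residue p∤a (z , z²≈a) =
    ∑<-two p (λ y → y ℕ.* y ≈? a) x<p p∸x<p x≢p∸x x²≈a (trans ([p∸x]²≈x² (ℕₚ.<⇒≤ x<p)) x²≈a)
      λ y<p y²≈a → squareRoots x<p y<p (trans y²≈a (sym x²≈a))
    where
    x = z % p
    x<p = m%n<n z p
    x²≈a = trans (*-cong-≈ (≈-%ˡ z) (≈-%ˡ z)) z²≈a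
    x≢0 : x ≢ 0
    x≢0 x≡0 = p∤a (∣-resp-≈ x²≈a (subst (λ x → p ∣ x ℕ.* x) (sym x≡0) (p ∣0)))
    instance
      x-nonZero : NonZero x
      x-nonZero = ℕ.≢-nonZero x≢0
    p∸x<p : p ℕ.∸ x ℕ.< p
    p∸x<p = ℕₚ.∸-monoʳ-< (ℕ.>-nonZero⁻¹ x) (ℕₚ.<⇒≤ x<p)
    -- Oddness keeps the two roots apart: if they coincided, `p` would be `2 x`.
    x≢p∸x : x ≢ p ℕ.∸ x
    x≢p∸x x≡p∸x = 2∤p (divides x (begin
      p                  ≡⟨ ℕₚ.m∸n+n≡m (ℕₚ.<⇒≤ x<p) ⟨
      p ℕ.∸ x ℕ.+ x      ≡⟨ cong (ℕ._+ x) x≡p∸x ⟨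
      x ℕ.+ x            ≡⟨ cong (x ℕ.+_) (ℕₚ.+-identityʳ x) ⟨
      2 ℕ.* x            ≡⟨ ℕₚ.*-comm 2 x ⟩
      x ℕ.* 2            ∎))
      where open ≡-Reasoning

  -- y² ≡ a has 1 + χ(a) solutions, so p + Σ χ(n x) counts the pairs (x , y) modulo p with
  -- y² ≡ n x; there are p of them, one for every y.
  ∑χ[nx]≡0 : ∀ {n} → ¬ (p ∣ n) → ∑< p (λ x → χ (n ℕ.* x)) ≡ 0ℤ
  ∑χ[nx]≡0 {n} p∤n = identityʳ-unique (∑< p (λ _ → 1ℤ)) _ (begin
    ∑< p (λ _ → 1ℤ) + ∑< p (λ x → χ (n ℕ.* x))               ≡⟨ ∑<-+ p _ _ ⟨
    ∑< p (λ x → 1ℤ + χ (n ℕ.* x))                            ≡⟨ ∑<-cong p (λ {x} _ → rootCount (n ℕ.* x)) ⟨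
    ∑< p (λ x → ∑< p (λ y → 𝟙 (y ℕ.* y ≈? n ℕ.* x)))         ≡⟨ ∑<-comm p p _ ⟩
    ∑< p (λ y → ∑< p (λ x → 𝟙 (y ℕ.* y ≈? n ℕ.* x)))         ≡⟨ ∑<-cong p (λ {y} _ → solutionCount (y ℕ.* y)) ⟩
    ∑< p (λ _ → 1ℤ)                                          ∎)
    where
    open ≡-Reasoning
    m = proj₁ (inverse p∤n)
    nm≈1 = proj₂ (inverse p∤n)
    solutionCount : ∀ b → ∑< p (λ x → 𝟙 (b ≈? n ℕ.* x)) ≡ 1ℤ
    solutionCount b = ∑<-one p (λ x → b ≈? n ℕ.* x) (m%n<n (m ℕ.* b) p) (sym solves)
      λ x<p b≈nx → ≈⇒≡ x<p (m%n<n (m ℕ.* b) p)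
        (*-cancelˡ-≈ p∤n (trans (sym b≈nx) (sym solves)))
      where
      solves : n ℕ.* ((m ℕ.* b) % p) ≈ b
      solves = begin
        (n ℕ.* ((m ℕ.* b) % p)) % p    ≡⟨ *-cong-≈ {n} refl (≈-%ˡ (m ℕ.* b)) ⟩
        (n ℕ.* (m ℕ.* b)) % p          ≡⟨ cong (_% p) (ℕₚ.*-assoc n m b) ⟨
        (n ℕ.* m ℕ.* b) % p            ≡⟨ *-cong-≈ {c = b} nm≈1 refl ⟩
        (1 ℕ.* b) % p                  ≡⟨ cong (_% p) (ℕₚ.*-identityˡ b) ⟩
        b % p                          ∎

  ∑χ≡0 : ∑< p χ ≡ 0ℤ
  ∑χ≡0 = trans (∑<-cong p λ {x} _ → cong χ (sym (ℕₚ.*-identityˡ x))) (∑χ[nx]≡0 p∤1)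

  p∤* : ∀ {m n} → ¬ (p ∣ m) → ¬ (p ∣ n) → ¬ (p ∣ m ℕ.* n)
  p∤* {m} {n} p∤m p∤n = [ p∤m , p∤n ]′ ∘ euclidsLemma m n p-prime

  χ-residue-* : ∀ {a} → ¬ (p ∣ a) → Square a → ∀ b → χ (a ℕ.* b) ≡ χ b
  χ-residue-* {a} p∤a sq b with χ b | χ-view b
  ... | _ | zero p∣b            = χ≡ (zero (∣n⇒∣m*n a p∣b))
  ... | _ | residue p∤b sq′     = χ≡ (residue (p∤* p∤a p∤b) (Square-* sq sq′))
  ... | _ | nonresidue p∤b ¬sq′ = χ≡ (nonresidue (p∤* p∤a p∤b) (¬sq′ ∘ Square-cancelˡ p∤a sq))

  -- χ(x) + χ(a x) is never positive when a is a nonresidue, and it has sum zero.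
  χ-nonresidue-* : ∀ {a} → ¬ (p ∣ a) → ¬ Square a → ∀ b → χ (a ℕ.* b) ≡ - χ b
  χ-nonresidue-* {a} p∤a ¬sq b = begin
    χ (a ℕ.* b)          ≡⟨ χ-cong (*-cong-≈ {a} refl (≈-%ˡ b)) ⟨
    χ (a ℕ.* (b % p))    ≡⟨ inverseʳ-unique (χ (b % p)) _ (∑<-nonPos-≡0 p nonPos sum≡0 (m%n<n b p)) ⟩
    - χ (b % p)          ≡⟨ cong -_ (χ-cong (≈-%ˡ b)) ⟩
    - χ b                ∎
    where
    open ≡-Reasoning
    nonPos : ∀ x → χ x + χ (a ℕ.* x) ≤ 0ℤ
    nonPos x with χ x | χ-view x
    ... | _ | zero p∣x       = ℤₚ.≤-reflexive (cong (λ i → 0ℤ + i) (χ≡ (zero (∣n⇒∣m*n a p∣x))))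
    ... | _ | residue p∤x (y , y²≈x) = ℤₚ.≤-reflexive (cong (λ i → 1ℤ + i) (χ≡ (nonresidue (p∤* p∤a p∤x)
      (¬sq ∘ Square-cancelˡ p∤x (y , y²≈x) ∘ subst Square (ℕₚ.*-comm a x)))))
    ... | _ | nonresidue _ _ = ℤₚ.+-monoʳ-≤ -1ℤ {χ (a ℕ.* x)} {1ℤ} (∣i∣≤1⇒i≤1 {χ (a ℕ.* x)} (∣χ∣≤1 (a ℕ.* x)))
      where
      ∣i∣≤1⇒i≤1 : ∀ {i} → ∣ i ∣ ℕ.≤ 1 → i ≤ 1ℤ
      ∣i∣≤1⇒i≤1 {+ n}         h = ℤ.+≤+ h
      ∣i∣≤1⇒i≤1 {ℤ.-[1+ n ]} h = ℤ.-≤+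
    sum≡0 : ∑< p (λ x → χ x + χ (a ℕ.* x)) ≡ 0ℤ
    sum≡0 = trans (∑<-+ p χ _) (cong₂ _+_ ∑χ≡0 (∑χ[nx]≡0 p∤a))

  χ-* : ∀ a b → χ (a ℕ.* b) ≡ χ a * χ b
  χ-* a b with χ a | χ-view a
  ... | _ | zero p∣a           = χ≡ (zero (∣m⇒∣m*n b p∣a))
  ... | _ | residue p∤a sq     = trans (χ-residue-* p∤a sq b) (sym (ℤₚ.*-identityˡ (χ b)))
  ... | _ | nonresidue p∤a ¬sq = trans (χ-nonresidue-* p∤a ¬sq b) (sym (ℤₚ.-1*i≡-i (χ b)))

  -- Digit recurrence for `L p`, with the bounds it gives

  lambda≡χ : ∀ n .{{_ : NonZero n}} → ¬ (p ∣ n) → lambda p n ≡ χ n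
  lambda≡χ n p∤n = trans
    (product-χ (factors f) (subst (λ m → ¬ (p ∣ m)) n≡ p∤n)) (cong χ (sym n≡))
    where
    f = factorise n
    n≡ = PrimeFactorisation.isFactorisation f
    open ≡-Reasoning
    product-χ : ∀ qs → ¬ (p ∣ product qs) → productℤ (map (lambdaAtPrime p) qs) ≡ χ (product qs)
    product-χ []       _   = sym χ[1]≡1
    product-χ (q ∷ qs) p∤ = begin
      lambdaAtPrime p q * productℤ (map (lambdaAtPrime p) qs)
        ≡⟨ cong₂ _*_
             -- A factor `q = p` would make `p` divide the product, so `lambdaAtPrime` takes its
             -- Legendre branch.
             (cong (if_then 1ℤ else χ q) (dec-false (q ℕₚ.≟ p) λ { refl → p∤ (m∣m*n (product qs)) }))
             (product-χ qs (p∤ ∘ ∣n⇒∣m*n q)) ⟩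
      χ q * χ (product qs)
        ≡⟨ χ-* q (product qs) ⟨
      χ (product (q ∷ qs)) ∎

  lambda[p*n]≡lambda[n] : ∀ n .{{_ : NonZero n}} → lambda p (p ℕ.* n) {{ℕₚ.m*n≢0 p n}} ≡ lambda p n
  lambda[p*n]≡lambda[n] n = begin
    lambda p (p ℕ.* n) {{ℕₚ.m*n≢0 p n}}  ≡⟨ lambda-* p p n ⟩
    lambda p p * lambda p n              ≡⟨ cong (_* lambda p n) (lambda-prime p p-prime) ⟩
    lambdaAtPrime p p * lambda p n
      ≡⟨ cong (λ b → (if b then 1ℤ else χ p) * lambda p n) (dec-true (p ℕₚ.≟ p) refl) ⟩
    1ℤ * lambda p n                      ≡⟨ ℤₚ.*-identityˡ _ ⟩
    lambda p n                           ∎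
    where open ≡-Reasoning

  -- The arguments `p q + 1, ..., p q + d` are prime to `p` and congruent to `1, ..., d`. The sum
  -- has `d + 1` terms because `∑<` starts at index 0, where `χ` vanishes.
  L-digit : ∀ q d → d ℕ.< p → L p (p ℕ.* q ℕ.+ d) ≡ L p (p ℕ.* q) + ∑< (suc d) χ
  L-digit q zero    _     = begin
    L p (p ℕ.* q ℕ.+ 0)            ≡⟨ cong (L p) (ℕₚ.+-identityʳ (p ℕ.* q)) ⟩
    L p (p ℕ.* q)                  ≡⟨ ℤₚ.+-identityʳ _ ⟨
    L p (p ℕ.* q) + 0ℤ             ≡⟨ cong (λ i → L p (p ℕ.* q) + (0ℤ + i)) χ[0]≡0 ⟨
    L p (p ℕ.* q) + ∑< 1 χ         ∎
    where open ≡-Reasoning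
  L-digit q (suc d) 1+d<p = begin
    L p (p ℕ.* q ℕ.+ suc d)                                     ≡⟨ cong (L p) (ℕₚ.+-suc (p ℕ.* q) d) ⟩
    L p (p ℕ.* q ℕ.+ d) + lambda p (suc (p ℕ.* q ℕ.+ d))        ≡⟨ cong₂ _+_ (L-digit q d (ℕₚ.<-trans (ℕₚ.n<1+n d) 1+d<p)) lambda≡ ⟩
    L p (p ℕ.* q) + ∑< (suc d) χ + χ (suc d)                    ≡⟨ ℤₚ.+-assoc (L p (p ℕ.* q)) _ _ ⟩
    L p (p ℕ.* q) + ∑< (suc (suc d)) χ                          ∎
    where
    open ≡-Reasoning
    ≈suc-d : suc (p ℕ.* q ℕ.+ d) ≈ suc d
    ≈suc-d = trans (cong (_% p) (sym (ℕₚ.+-suc (p ℕ.* q) d))) (%-remove-+ˡ (suc d) (m∣m*n q))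
    lambda≡ : lambda p (suc (p ℕ.* q ℕ.+ d)) ≡ χ (suc d)
    lambda≡ = trans
      (lambda≡χ _ λ p∣ → ℕₚ.<⇒≱ 1+d<p (∣⇒≤ (∣-resp-≈ ≈suc-d p∣)))
      (χ-cong ≈suc-d)

  -- Between `p n` and `p (n + 1)` the arguments prime to `p` contribute a full period of `χ`, which
  -- is zero, and the last argument contributes `λ_p(p (n + 1)) = λ_p(n + 1)`: both sides grow
  -- alike.
  L[p*n]≡L[n] : ∀ n → L p (p ℕ.* n) ≡ L p n
  L[p*n]≡L[n] zero    = cong (L p) (ℕₚ.*-zeroʳ p)
  L[p*n]≡L[n] (suc n) = begin
    L p (p ℕ.* suc n)                                              ≡⟨ cong (L p) eq ⟩
    L p (p ℕ.* n ℕ.+ ℕ.pred p) + lambda p (suc (p ℕ.* n ℕ.+ ℕ.pred p))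
      ≡⟨ cong₂ _+_ (L-digit n (ℕ.pred p) (ℕₚ.≤-reflexive (ℕₚ.suc-pred p)))
           (trans (lambda-cong (sym eq)) (lambda[p*n]≡lambda[n] (suc n))) ⟩
    L p (p ℕ.* n) + ∑< (suc (ℕ.pred p)) χ + lambda p (suc n)
      ≡⟨ cong (_+ lambda p (suc n)) (cong₂ _+_ (L[p*n]≡L[n] n)
           (trans (cong (λ m → ∑< m χ) (ℕₚ.suc-pred p)) ∑χ≡0)) ⟩
    L p n + 0ℤ + lambda p (suc n)
      ≡⟨ cong (_+ lambda p (suc n)) (ℤₚ.+-identityʳ (L p n)) ⟩
    L p (suc n) ∎
    where
    open ≡-Reasoning
    lambda-cong : ∀ {a b} .{{_ : NonZero a}} .{{_ : NonZero b}} → a ≡ b → lambda p a ≡ lambda p b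
    lambda-cong refl = refl
    instance
      p*[1+n]≢0 = ℕₚ.m*n≢0 p (suc n)
    eq : p ℕ.* suc n ≡ suc (p ℕ.* n ℕ.+ ℕ.pred p)
    eq = trans (ℕₚ.*-suc p n) (trans (ℕₚ.+-comm p (p ℕ.* n))
      (trans (cong (p ℕ.* n ℕ.+_) (sym (ℕₚ.suc-pred p))) (ℕₚ.+-suc (p ℕ.* n) (ℕ.pred p))))

  L-recurrence : ∀ q d → d ℕ.< p → L p (p ℕ.* q ℕ.+ d) ≡ L p q + ∑< (suc d) χ
  L-recurrence q d d<p = trans (L-digit q d d<p) (cong (_+ ∑< (suc d) χ) (L[p*n]≡L[n] q))

  ∣∑χ∣≤n : ∀ n → ∣ ∑< n χ ∣ ℕ.≤ n
  ∣∑χ∣≤n zero    = z≤n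
  ∣∑χ∣≤n (suc n) = ℕₚ.≤-trans (ℤₚ.∣i+j∣≤∣i∣+∣j∣ (∑< n χ) (χ n))
    (subst (∣ ∑< n χ ∣ ℕ.+ ∣ χ n ∣ ℕ.≤_) (ℕₚ.+-comm n 1) (ℕₚ.+-mono-≤ (∣∑χ∣≤n n) (∣χ∣≤1 n)))

  -- The hypothesis caps the number of digits but allows leading zeros, so it passes directly to the
  -- quotient by `p`. A digit `d` costs at most `d + 1 ≤ p`.
  ∣L∣≤ : ∀ k {n} → n ℕ.< p ℕ.^ k → ∣ L p n ∣ ℕ.≤ k ℕ.* p
  ∣L∣≤ zero    {zero}  _         = z≤n
  ∣L∣≤ zero    {suc n} (s≤s ())
  ∣L∣≤ (suc k) {n} n<p^[1+k] = begin
    ∣ L p n ∣                                ≡⟨ cong (∣_∣ ∘ L p) n≡ ⟩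
    ∣ L p (p ℕ.* q ℕ.+ d) ∣                  ≡⟨ cong ∣_∣ (L-recurrence q d (m%n<n n p)) ⟩
    ∣ L p q + ∑< (suc d) χ ∣                 ≤⟨ ℤₚ.∣i+j∣≤∣i∣+∣j∣ (L p q) _ ⟩
    ∣ L p q ∣ ℕ.+ ∣ ∑< (suc d) χ ∣           ≤⟨ ℕₚ.+-mono-≤ (∣L∣≤ k q<p^k) (ℕₚ.≤-trans (∣∑χ∣≤n (suc d)) (m%n<n n p)) ⟩
    k ℕ.* p ℕ.+ p                            ≡⟨ ℕₚ.+-comm (k ℕ.* p) p ⟩
    suc k ℕ.* p                              ∎
    where
    open ℕₚ.≤-Reasoning
    q = n ℕ./ p
    d = n % p
    n≡ : n ≡ p ℕ.* q ℕ.+ d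
    n≡ = trans (m≡m%n+[m/n]*n n p) (trans (ℕₚ.+-comm d (q ℕ.* p)) (cong (ℕ._+ d) (ℕₚ.*-comm q p)))
    q<p^k : q ℕ.< p ℕ.^ k
    q<p^k = m<n*o⇒m/o<n (subst (n ℕ.<_) (ℕₚ.*-comm p (p ℕ.^ k)) n<p^[1+k])

  -- Horner form of `1 + p + ... + p^(k-1)`, so that `L-recurrence` applies with digit 1.
  repunit : ℕ → ℕ
  repunit zero    = 0
  repunit (suc k) = p ℕ.* repunit k ℕ.+ 1

  1<p : 1 ℕ.< p
  1<p = ℕ.nonTrivial⇒n>1 p {{prime⇒nonTrivial p-prime}}

  repunit<p^k : ∀ k → repunit k ℕ.< p ℕ.^ k
  repunit<p^k zero    = ℕₚ.≤-refl
  repunit<p^k (suc k) = begin-strict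
    p ℕ.* repunit k ℕ.+ 1     <⟨ ℕₚ.+-monoʳ-< (p ℕ.* repunit k) 1<p ⟩
    p ℕ.* repunit k ℕ.+ p     ≡⟨ ℕₚ.+-comm (p ℕ.* repunit k) p ⟩
    p ℕ.+ p ℕ.* repunit k     ≡⟨ ℕₚ.*-suc p (repunit k) ⟨
    p ℕ.* suc (repunit k)     ≤⟨ ℕₚ.*-monoʳ-≤ p (repunit<p^k k) ⟩
    p ℕ.* p ℕ.^ k             ∎
    where open ℕₚ.≤-Reasoning

  L[repunit] : ∀ k → L p (repunit k) ≡ + k
  L[repunit] zero    = refl
  L[repunit] (suc k) = begin
    L p (p ℕ.* repunit k ℕ.+ 1)         ≡⟨ L-recurrence (repunit k) 1 1<p ⟩
    L p (repunit k) + (0ℤ + χ 0 + χ 1)  ≡⟨ cong₂ _+_ (L[repunit] k) (cong₂ (λ i j → 0ℤ + i + j) χ[0]≡0 χ[1]≡1) ⟩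
    + k + 1ℤ                            ≡⟨ ℤₚ.+-comm (+ k) 1ℤ ⟩
    + suc k                             ∎
    where open ≡-Reasoning

-- Bounds for the logarithm

module _ where

  open import Data.Rational.Base using (0ℚ; 1ℚ; _+_; _-_; _*_; _<_)

  ι-suc : ∀ n → ι (suc n) ≡ 1ℚ + ι n
  ι-suc n = ι-+ 1 n

  ι-cancel-≤ : ∀ a b → ι a ≤ℚ ι b → a ℕ.≤ b
  ι-cancel-≤ a b ιa≤ιb = ℤₚ.drop‿+≤+ (subst₂ ℤ._≤_ (ℤₚ.*-identityʳ (+ a)) (ℤₚ.*-identityʳ (+ b))
    (ℚᵘₚ.drop-*≤* (ℚᵘₚ.≤-respˡ-≃ (toℚᵘ-/ (+ a) 0) (ℚᵘₚ.≤-respʳ-≃ (toℚᵘ-/ (+ b) 0) (ℚₚ.toℚᵘ-mono-≤ ιa≤ιb)))))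

  0≤ι : ∀ n → 0ℚ ≤ℚ ι n
  0≤ι n = ℚₚ.nonNegative⁻¹ (ι n) {{ι-nonNeg n}}

  1+p-1≡p : ∀ p → 1ℚ + p - 1ℚ ≡ p
  1+p-1≡p = q+r-q≡r 1ℚ

  -- Absorbs the slack when `≤ᴿ` or `cauchy` is used at tolerance 1: a natural lower bound on a real
  -- drops by one unit on the terms of its sequence.
  ι-suc≤q+1⇒ι≤q : ∀ n q → ι (suc n) ≤ℚ q + 1ℚ → ι n ≤ℚ q
  ι-suc≤q+1⇒ι≤q n q h = begin
    ι n             ≡⟨ 1+p-1≡p (ι n) ⟨
    1ℚ + ι n - 1ℚ   ≡⟨ cong (_- 1ℚ) (ι-suc n) ⟨
    ι (suc n) - 1ℚ  ≤⟨ ℚₚ.+-monoˡ-≤ (ℚ.- 1ℚ) h ⟩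
    q + 1ℚ - 1ℚ     ≡⟨ cong (_- 1ℚ) (ℚₚ.+-comm q 1ℚ) ⟩
    1ℚ + q - 1ℚ     ≡⟨ 1+p-1≡p q ⟩
    q               ∎
    where open ℚₚ.≤-Reasoning

  p≤q⇒p≤q+ε : ∀ p q {ε} → 0ℚ < ε → p ≤ℚ q → p ≤ℚ q + ε
  p≤q⇒p≤q+ε p q {ε} 0<ε p≤q = subst (_≤ℚ q + ε) (ℚₚ.+-identityʳ p) (ℚₚ.+-mono-≤ p≤q (ℚₚ.<⇒≤ 0<ε))

  fromℕ-pos : ∀ {n} → 1 ℕ.≤ n → 0ᴿ <ᴿ fromℕ n
  fromℕ-pos 1≤n = 1ℚ , ℚₚ.positive⁻¹ 1ℚ , 0 , λ _ _ → ι-mono 1≤n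

  0≤recipSum : ∀ n m → 0ℚ ≤ℚ recipSum n m
  0≤recipSum n m = recipSum-mono n {0} {m} z≤n

  steps-upper : ∀ j q s → q ≤ℚ ι (suc s) → steps j q ℕ.≤ suc j ℕ.* s
  steps-upper j q s q≤1+s = ι-cancel-≤ (steps j q) (suc j ℕ.* s) (begin
    ι (steps j q)         ≤⟨ proj₁ (steps-bounds j q) ⟩
    ι (suc j) * excess q  ≤⟨ ℚₚ.*-monoˡ-≤-nonNeg (ι (suc j)) {{ι-nonNeg (suc j)}} excess≤s ⟩
    ι (suc j) * ι s       ≡⟨ ι-* (suc j) s ⟨
    ι (suc j ℕ.* s)       ∎)
    where
    open ℚₚ.≤-Reasoning
    excess≤s : excess q ≤ℚ ι s
    excess≤s = ℚₚ.⊔-lub (0≤ι s) (p-q≤r {q} {1ℚ} {ι s} (subst (q ≤ℚ_) (ι-suc s) q≤1+s))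

  -- The sharp hypothesis would be `1 + s`. The spare unit is worth `suc j` steps and pays for the
  -- one step lost in the floor bound `y ≤ floor y + 1`.
  steps-lower : ∀ j q s → ι (2 ℕ.+ s) ≤ℚ q → suc j ℕ.* s ℕ.≤ steps j q
  steps-lower j q s 2+s≤q = ℕₚ.≤-pred (ι-cancel-≤ (suc (suc j ℕ.* s)) (suc (steps j q)) (begin
    ι (suc (suc j ℕ.* s))         ≤⟨ ι-mono (ℕₚ.+-monoˡ-≤ (suc j ℕ.* s) (s≤s (z≤n {j}))) ⟩
    ι (suc j ℕ.+ suc j ℕ.* s)     ≡⟨ cong ι (ℕₚ.*-suc (suc j) s) ⟨
    ι (suc j ℕ.* suc s)           ≡⟨ ι-* (suc j) (suc s) ⟩
    ι (suc j) * ι (suc s)         ≤⟨ ℚₚ.*-monoˡ-≤-nonNeg (ι (suc j)) {{ι-nonNeg (suc j)}} 1+s≤excess ⟩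
    ι (suc j) * excess q          ≤⟨ proj₂ (steps-bounds j q) ⟩
    ι (steps j q) + 1ℚ            ≡⟨ ℚₚ.+-comm (ι (steps j q)) 1ℚ ⟩
    1ℚ + ι (steps j q)            ≡⟨ ι-suc (steps j q) ⟨
    ι (suc (steps j q))           ∎))
    where
    open ℚₚ.≤-Reasoning
    1+s≤excess : ι (suc s) ≤ℚ excess q
    1+s≤excess = begin
      ι (suc s)               ≡⟨ 1+p-1≡p (ι (suc s)) ⟨
      1ℚ + ι (suc s) - 1ℚ     ≡⟨ cong (_- 1ℚ) (ι-suc (suc s)) ⟨
      ι (2 ℕ.+ s) - 1ℚ        ≤⟨ ℚₚ.+-monoˡ-≤ (ℚ.- 1ℚ) 2+s≤q ⟩
      q - 1ℚ                  ≤⟨ ℚₚ.p≤q⊔p 0ℚ (q - 1ℚ) ⟩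
      excess q                ∎

  -- The block is a Riemann sum for `log (1 + c)`: its `c (n + 1)` denominators run from `n + 2` to
  -- `(1 + c) (n + 1)`. Largest and smallest term give `c` and `c / (1 + c)`, uniformly in `n`; the
  -- lower bound is then weakened to `1 / (1 + c)`.
  recipSum-block-upper : ∀ c n → recipSum (suc n) (c ℕ.* suc n) ≤ℚ ι c
  recipSum-block-upper c n = begin
    recipSum (suc n) (c ℕ.* suc n)  ≤⟨ recipSum-upper (suc n) (c ℕ.* suc n) n (ℕₚ.n≤1+n n) ⟩
    ι (c ℕ.* suc n) * r n           ≡⟨ cong (_* r n) (ι-* c (suc n)) ⟩
    ι c * ι (suc n) * r n           ≡⟨ ℚₚ.*-assoc (ι c) (ι (suc n)) (r n) ⟩
    ι c * (ι (suc n) * r n)         ≡⟨ cong (ι c *_) (ι*r≡1 n) ⟩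
    ι c * 1ℚ                        ≡⟨ ℚₚ.*-identityʳ (ι c) ⟩
    ι c                             ∎
    where open ℚₚ.≤-Reasoning

  recipSum-block-lower : ∀ {c} → 1 ℕ.≤ c → ∀ n → r c ≤ℚ recipSum (suc n) (c ℕ.* suc n)
  recipSum-block-lower {c} 1≤c n = begin
    r c                             ≡⟨ ℚₚ.*-identityˡ (r c) ⟨
    ι 1 * r c                       ≤⟨ ℚₚ.*-monoʳ-≤-nonNeg (r c) {{r-nonNeg c}} (ι-mono 1≤c) ⟩
    ι c * r c                       ≡⟨ cong (ι c *_) (ι*r≡r n c B (ℕₚ.*-comm (suc c) (suc n))) ⟨
    ι c * (ι (suc n) * r B)         ≡⟨ ℚₚ.*-assoc (ι c) (ι (suc n)) (r B) ⟨
    ι c * ι (suc n) * r B           ≡⟨ cong (_* r B) (ι-* c (suc n)) ⟨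
    ι (c ℕ.* suc n) * r B           ≤⟨ recipSum-lower (suc n) (c ℕ.* suc n) B ℕₚ.≤-refl ⟩
    recipSum (suc n) (c ℕ.* suc n)  ∎
    where
    open ℚₚ.≤-Reasoning
    -- Chosen so that `suc B` computes to `suc c * suc n`, the last denominator of the block.
    B = n ℕ.+ c ℕ.* suc n

  -- This is `(1 + c)^k - 1`, the length of `[1, (1 + c)^k]`, written without subtraction so that
  -- its successor unfolds as a power does. Steps of length `1 / K` cover that interval in
  -- `K * powerPred c k`.
  powerPred : ℕ → ℕ → ℕ
  powerPred c zero    = 0
  powerPred c (suc k) = powerPred c k ℕ.+ c ℕ.* suc (powerPred c k)

  1+powerPred≡^ : ∀ c k → suc (powerPred c k) ≡ suc c ℕ.^ k
  1+powerPred≡^ c zero    = refl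
  1+powerPred≡^ c (suc k) = cong (suc c ℕ.*_) (1+powerPred≡^ c k)

  -- Cutting [1, (1 + c)^k] at the powers of 1 + c splits the Riemann sum into k blocks,
  -- each of which lies between 1 / (1 + c) and c.
  recipSum-blocks : ∀ c j k → let K = suc j; s = powerPred c k in
    recipSum K (K ℕ.* powerPred c (suc k)) ≡
    recipSum K (K ℕ.* s) + recipSum (K ℕ.+ K ℕ.* s) (c ℕ.* (K ℕ.+ K ℕ.* s))
  recipSum-blocks c j k = trans (cong (recipSum (suc j)) (expand (suc j) c (powerPred c k)))
    (recipSum-+ (suc j) (suc j ℕ.* powerPred c k) _)
    where
    expand : ∀ K c s → K ℕ.* (s ℕ.+ c ℕ.* suc s) ≡ K ℕ.* s ℕ.+ c ℕ.* (K ℕ.+ K ℕ.* s)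
    expand = ℕ-Solver.solve-∀

  recipSum-power-upper : ∀ c j k → recipSum (suc j) (suc j ℕ.* powerPred c k) ≤ℚ ι k * ι c
  recipSum-power-upper c j zero    = ℚₚ.≤-reflexive
    (trans (cong (recipSum (suc j)) (ℕₚ.*-zeroʳ (suc j))) (sym (ℚₚ.*-zeroˡ (ι c))))
  recipSum-power-upper c j (suc k) = subst₂ _≤ℚ_ (sym (recipSum-blocks c j k)) (sym (ι-suc-* k (ι c)))
    (ℚₚ.+-mono-≤ (recipSum-power-upper c j k) (recipSum-block-upper c (j ℕ.+ suc j ℕ.* powerPred c k)))

  recipSum-power-lower : ∀ {c} → 1 ℕ.≤ c → ∀ j k → ι k * r c ≤ℚ recipSum (suc j) (suc j ℕ.* powerPred c k)
  recipSum-power-lower {c} 1≤c j zero    = ℚₚ.≤-reflexive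
    (trans (ℚₚ.*-zeroˡ (r c)) (sym (cong (recipSum (suc j)) (ℕₚ.*-zeroʳ (suc j)))))
  recipSum-power-lower {c} 1≤c j (suc k) = subst₂ _≤ℚ_ (sym (ι-suc-* k (r c))) (sym (recipSum-blocks c j k))
    (ℚₚ.+-mono-≤ (recipSum-power-lower 1≤c j k) (recipSum-block-lower 1≤c (j ℕ.+ suc j ℕ.* powerPred c k)))

  -- seq (log x) j is logSum j (seq x j) by definition.
  logSum : ℕ → ℚ → ℚ
  logSum j q = recipSum (suc j) (steps j q)

  logSum-upper : ∀ c j k q → q ≤ℚ ι (suc c ℕ.^ k) → logSum j q ≤ℚ ι k * ι c
  logSum-upper c j k q q≤ = ℚₚ.≤-trans
    (recipSum-mono (suc j) (steps-upper j q (powerPred c k) (subst (λ n → q ≤ℚ ι n) (sym (1+powerPred≡^ c k)) q≤)))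
    (recipSum-power-upper c j k)

  -- One factor `1 + c` is given up. Since `c ≥ 2` it adds at least 2 to `(1 + c)^k`, which covers
  -- the slack in the hypothesis and the spare unit of `steps-lower`.
  logSum-lower : ∀ {c} → 2 ℕ.≤ c → ∀ j k q → ι (suc c ℕ.^ suc k) ≤ℚ q + 1ℚ → ι k * r c ≤ℚ logSum j q
  logSum-lower {c} 2≤c j k q ≤q+1 = ℚₚ.≤-trans
    (recipSum-power-lower (ℕₚ.<⇒≤ 2≤c) j k)
    (recipSum-mono (suc j) (steps-lower j q s
      (ι-suc≤q+1⇒ι≤q (2 ℕ.+ s) q (ℚₚ.≤-trans (ι-mono 3+s≤) ≤q+1))))
    where
    s = powerPred c k
    3+s≤ : 3 ℕ.+ s ℕ.≤ suc c ℕ.^ suc k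
    3+s≤ = begin
      3 ℕ.+ s                   ≡⟨ cong suc (ℕₚ.+-comm 2 s) ⟩
      suc s ℕ.+ 2               ≤⟨ ℕₚ.+-monoʳ-≤ (suc s) (ℕₚ.≤-trans 2≤c (ℕₚ.m≤m*n c (suc s))) ⟩
      suc s ℕ.+ c ℕ.* suc s     ≡⟨ 1+powerPred≡^ c (suc k) ⟩
      suc c ℕ.^ suc k           ∎
      where open ℕₚ.≤-Reasoning

  -- Stands in for the floor of a real: take the rational floor of a single term `y`, from which
  -- later terms differ by less than 1, and set `n = floor y - 1`. The terms then stay above
  -- `floor y - 1 = n` and below `floor y + 2 = n + 3`. Starting from `3 + B` leaves
  -- `floor y ≥ 1 + B`, so that `n ≥ B`.
  ≤ᴿ-natApprox : ∀ x B → fromℕ (3 ℕ.+ B) ≤ᴿ x →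
    ∃[ n ] B ℕ.≤ n × ∃[ N ] ∀ j → N ℕ.≤ j → ι n ≤ℚ seq x j × seq x j ≤ℚ ι (3 ℕ.+ n)
  ≤ᴿ-natApprox x B 3+B≤x = approx ∣ floor y ∣ 1+B≤floor floor≤y y≤floor+1
    where
    0<1 = ℚₚ.positive⁻¹ 1ℚ
    N₁ = proj₁ (3+B≤x 1ℚ 0<1)
    N₂ = proj₁ (cauchy x 1ℚ 0<1)
    N = N₁ ℕ.⊔ N₂
    y = seq x N
    2+B≤y : ι (2 ℕ.+ B) ≤ℚ y
    2+B≤y = ι-suc≤q+1⇒ι≤q (2 ℕ.+ B) y (proj₂ (3+B≤x 1ℚ 0<1) N (ℕₚ.m≤m⊔n N₁ N₂))
    0≤y : 0ℚ ≤ℚ y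
    0≤y = ℚₚ.≤-trans (0≤ι (2 ℕ.+ B)) 2+B≤y
    floor≤y = proj₁ (floor-bounds y 0≤y)
    y≤floor+1 = proj₂ (floor-bounds y 0≤y)
    1+B≤floor : suc B ℕ.≤ ∣ floor y ∣
    1+B≤floor = ι-cancel-≤ (suc B) ∣ floor y ∣
      (ι-suc≤q+1⇒ι≤q (suc B) (ι ∣ floor y ∣) (ℚₚ.≤-trans 2+B≤y y≤floor+1))
    near : ∀ i j → N ℕ.≤ i → N ℕ.≤ j → seq x i ≤ℚ seq x j + 1ℚ
    near i j N≤i N≤j = ℚₚ.≤-trans (p≤q+∣p-q∣ (seq x i) (seq x j))
      (ℚₚ.+-monoʳ-≤ (seq x j) (ℚₚ.<⇒≤ (proj₂ (cauchy x 1ℚ 0<1) i j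
        (ℕₚ.m⊔n≤o⇒n≤o N₁ N₂ N≤i) (ℕₚ.m⊔n≤o⇒n≤o N₁ N₂ N≤j))))
    approx : ∀ f → suc B ℕ.≤ f → ι f ≤ℚ y → y ≤ℚ ι f + 1ℚ →
      ∃[ n ] B ℕ.≤ n × ∃[ N ] ∀ j → N ℕ.≤ j → ι n ≤ℚ seq x j × seq x j ≤ℚ ι (3 ℕ.+ n)
    approx (suc n) (s≤s B≤n) f≤y y≤f+1 = n , B≤n , N , λ j N≤j → lower j N≤j , upper j N≤j
      where
      open ℚₚ.≤-Reasoning
      lower : ∀ j → N ℕ.≤ j → ι n ≤ℚ seq x j
      lower j N≤j = ι-suc≤q+1⇒ι≤q n (seq x j) (ℚₚ.≤-trans f≤y (near N j ℕₚ.≤-refl N≤j))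
      upper : ∀ j → N ℕ.≤ j → seq x j ≤ℚ ι (3 ℕ.+ n)
      upper j N≤j = begin
        seq x j                     ≤⟨ near j N N≤j ℕₚ.≤-refl ⟩
        y + 1ℚ                      ≤⟨ ℚₚ.+-monoˡ-≤ 1ℚ y≤f+1 ⟩
        ι (suc n) + 1ℚ + 1ℚ         ≡⟨ ℚₚ.+-comm (ι (suc n) + 1ℚ) 1ℚ ⟩
        1ℚ + (ι (suc n) + 1ℚ)       ≡⟨ cong (λ z → 1ℚ + z) (ℚₚ.+-comm (ι (suc n)) 1ℚ) ⟩
        1ℚ + (1ℚ + ι (suc n))       ≡⟨ cong (λ z → 1ℚ + z) (ι-suc (suc n)) ⟨
        1ℚ + ι (2 ℕ.+ n)            ≡⟨ ι-suc (2 ℕ.+ n) ⟨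
        ι (3 ℕ.+ n)                 ∎

-- Comparison of `L p` and its maximum with the logarithm

powerBracket : ∀ {b} → 1 ℕ.< b → ∀ n → 1 ℕ.≤ n → ∃[ k ] b ℕ.^ k ℕ.≤ n × n ℕ.< b ℕ.^ suc k
powerBracket {b} 1<b (suc zero)    _ = 0 , ℕₚ.≤-refl , subst (1 ℕ.<_) (sym (ℕₚ.*-identityʳ b)) 1<b
powerBracket {b} 1<b (suc (suc n)) _ with powerBracket 1<b (suc n) (s≤s z≤n)
... | k , b^k≤ , <b^[1+k] with ℕₚ.m≤n⇒m<n∨m≡n <b^[1+k]
...   | inj₁ 2+n<b^ = k , ℕₚ.m≤n⇒m≤1+n b^k≤ , 2+n<b^
-- Adding one can reach the next power only by equality, and then the exponent moves up.
...   | inj₂ 2+n≡b^ = suc k , ℕₚ.≤-reflexive (sym 2+n≡b^) ,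
  subst (ℕ._< b ℕ.^ (2 ℕ.+ k)) (sym 2+n≡b^) (ℕₚ.^-monoʳ-< b 1<b (ℕₚ.n<1+n (suc k)))

-- Source of the factor 3 in both implied constants: in each direction an upper bound with exponent
-- `3 + k` meets a lower bound worth `1 + k`.
[3+k]*n≤3n*[1+k] : ∀ k n → (3 ℕ.+ k) ℕ.* n ℕ.≤ 3 ℕ.* n ℕ.* suc k
[3+k]*n≤3n*[1+k] k n = subst ((3 ℕ.+ k) ℕ.* n ℕ.≤_) (eq k n) (ℕₚ.*-monoˡ-≤ n (ℕₚ.+-monoʳ-≤ 3 (ℕₚ.m≤n*m k 3)))
  where
  eq : ∀ k n → (3 ℕ.+ 3 ℕ.* k) ℕ.* n ≡ 3 ℕ.* n ℕ.* suc k
  eq = ℕ-Solver.solve-∀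

module _ {c : ℕ} (p-prime : Prime (suc c)) (2∤p : ¬ (2 ∣ suc c)) where

  open OddPrime p-prime 2∤p
  open import Data.Rational.Base using (0ℚ; 1ℚ; _+_; _*_; _<_)

  private
    p = suc c
    -- `∣ L p n ∣` is at most `3 p (1 + k)`, while the logarithm is at least `(1 + k) / p`.
    C = 3 ℕ.* p ℕ.* p

  2≤c : 2 ℕ.≤ c
  2≤c = ℕₚ.≤∧≢⇒< (ℕₚ.≤-pred 1<p) λ 1≡c → 2∤p (∣-reflexive (cong suc 1≡c))

  -- `logSum-lower` gives up one power, and a block must remain for the lower bound to be positive;
  -- hence the threshold `p^2`.
  powerBracket≥2 : ∀ n → p ℕ.^ 2 ℕ.≤ n → ∃[ k ] p ℕ.^ (2 ℕ.+ k) ℕ.≤ n × n ℕ.< p ℕ.^ (3 ℕ.+ k)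
  powerBracket≥2 n p²≤n with powerBracket 1<p n (ℕₚ.≤-trans (s≤s z≤n) p²≤n)
  ... | 0 , _ , n<p  = contradiction (ℕₚ.<-≤-trans n<p (ℕₚ.^-monoʳ-≤ p {1} {2} (s≤s z≤n))) (ℕₚ.≤⇒≯ p²≤n)
  ... | 1 , _ , n<p² = contradiction n<p² (ℕₚ.≤⇒≯ p²≤n)
  ... | suc (suc k) , bracket = k , bracket

  ∣L∣≤logSum : ∀ j n q → ι n ≤ℚ q + 1ℚ → ι (p ℕ.^ 2) ≤ℚ q + 1ℚ →
               ι ∣ L p n ∣ ≤ℚ ι C * logSum j q
  ∣L∣≤logSum j n q n≤q+1 p²≤q+1 = begin
    ι ∣ L p n ∣                           ≤⟨ ι-mono ∣L∣≤3p*[1+k] ⟩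
    ι (3p ℕ.* suc k)                      ≡⟨ ι-* 3p (suc k) ⟩
    ι 3p * ι (suc k)                      ≡⟨ cong (ι 3p *_) (ℚₚ.*-identityʳ (ι (suc k))) ⟨
    ι 3p * (ι (suc k) * 1ℚ)               ≡⟨ cong (λ z → ι 3p * (ι (suc k) * z)) (ι*r≡1 c) ⟨
    ι 3p * (ι (suc k) * (ι p * r c))      ≡⟨ cong (ι 3p *_) (x∙yz≈y∙xz (ι (suc k)) (ι p) (r c)) ⟩
    ι 3p * (ι p * (ι (suc k) * r c))      ≡⟨ ℚₚ.*-assoc (ι 3p) (ι p) _ ⟨
    ι 3p * ι p * (ι (suc k) * r c)        ≡⟨ cong (_* (ι (suc k) * r c)) (ι-* 3p p) ⟨
    ι C * (ι (suc k) * r c)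
      ≤⟨ ℚₚ.*-monoˡ-≤-nonNeg (ι C) {{ι-nonNeg C}}
           (logSum-lower 2≤c j (suc k) q (ℚₚ.≤-trans (ι-mono p^[2+k]≤M) M≤q+1)) ⟩
    ι C * logSum j q                      ∎
    where
    open ℚₚ.≤-Reasoning
    3p = 3 ℕ.* p
    -- A point where the maximum is attained may be small even for large `x`. Raising it to `p^2`
    -- makes the bracket available while `M` still satisfies both hypotheses on `q`.
    M = n ℕ.⊔ p ℕ.^ 2
    bracket = powerBracket≥2 M (ℕₚ.m≤n⊔m n (p ℕ.^ 2))
    k = proj₁ bracket
    p^[2+k]≤M = proj₁ (proj₂ bracket)
    M≤q+1 : ι M ≤ℚ q + 1ℚ
    M≤q+1 = [ (λ e → subst (λ m → ι m ≤ℚ q + 1ℚ) (sym e) n≤q+1)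
            , (λ e → subst (λ m → ι m ≤ℚ q + 1ℚ) (sym e) p²≤q+1) ]′ (ℕₚ.⊔-sel n (p ℕ.^ 2))
    ∣L∣≤3p*[1+k] : ∣ L p n ∣ ℕ.≤ 3p ℕ.* suc k
    ∣L∣≤3p*[1+k] = ℕₚ.≤-trans
      (∣L∣≤ (3 ℕ.+ k) (ℕₚ.≤-<-trans (ℕₚ.m≤m⊔n n (p ℕ.^ 2)) (proj₂ (proj₂ bracket))))
      ([3+k]*n≤3n*[1+k] k p)

  -- Keeping `n` and `x` apart serves both upper estimates: `x = n` for the pointwise one, and `n` a
  -- point of maximum for the other. The index comes from the hypotheses at tolerance 1, whatever
  -- `ε` is.
  ∣L∣≤C*log : ∀ x n → fromℕ n ≤ᴿ x → fromℕ (p ℕ.^ 2) ≤ᴿ x →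
              ∣ fromℕ ∣ L p n ∣ ∣ᴿ ≤ᴿ fromℕ C *ᴿ log x
  ∣L∣≤C*log x n n≤x p²≤x ε 0<ε = N₁ ℕ.⊔ N₂ , λ j N≤j →
    p≤q⇒p≤q+ε ℚ.∣ ι (∣ L p n ∣) ∣ (ι C * logSum j (seq x j)) 0<ε (ℚₚ.≤-trans
      (ℚₚ.≤-reflexive (ℚₚ.0≤p⇒∣p∣≡p (0≤ι ∣ L p n ∣)))
      (∣L∣≤logSum j n (seq x j)
        (proj₂ (n≤x 1ℚ 0<1) j (ℕₚ.m⊔n≤o⇒m≤o N₁ N₂ N≤j))
        (proj₂ (p²≤x 1ℚ 0<1) j (ℕₚ.m⊔n≤o⇒n≤o N₁ N₂ N≤j))))
    where
    0<1 = ℚₚ.positive⁻¹ 1ℚ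
    N₁ = proj₁ (n≤x 1ℚ 0<1)
    N₂ = proj₁ (p²≤x 1ℚ 0<1)

  0<C : 0ᴿ <ᴿ fromℕ C
  0<C = fromℕ-pos {C} (s≤s z≤n)

  ∣L∣≪log : (λ n → fromℕ ∣ L p n ∣) ≪[ fromℕ ] (λ n → log (fromℕ n))
  ∣L∣≪log = fromℕ C , 0<C , fromℕ (p ℕ.^ 2) , λ n p²≤n →
    ∣L∣≤C*log (fromℕ n) n (λ ε 0<ε → 0 , λ _ _ → p≤q⇒p≤q+ε (ι n) (ι n) 0<ε ℚₚ.≤-refl) p²≤n

  max≪log : (λ (m : MaxL p) → fromℕ (MaxL.max m)) ≪[ MaxL.x ] (λ m → log (MaxL.x m))
  max≪log = fromℕ C , 0<C , fromℕ (p ℕ.^ 2) , λ m p²≤x →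
    let (n , _ , n≤x , ∣L∣≡max) , _ = MaxL.isMax m in
    subst (λ k → ∣ fromℕ k ∣ᴿ ≤ᴿ fromℕ C *ᴿ log (MaxL.x m)) ∣L∣≡max (∣L∣≤C*log (MaxL.x m) n n≤x p²≤x)

  1+k≤max : ∀ (m : MaxL p) k → fromℕ (p ℕ.^ suc k) ≤ᴿ MaxL.x m → suc k ℕ.≤ MaxL.max m
  1+k≤max m k p^[1+k]≤x = subst (ℕ._≤ MaxL.max m) (cong ∣_∣ (L[repunit] (suc k)))
    (proj₂ (MaxL.isMax m) (repunit (suc k)) (ℕₚ.m≤n+m 1 (p ℕ.* repunit k)) repunit≤x)
    where
    repunit≤x : fromℕ (repunit (suc k)) ≤ᴿ MaxL.x m
    repunit≤x ε 0<ε = proj₁ (p^[1+k]≤x ε 0<ε) , λ j N≤j →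
      ℚₚ.≤-trans (ι-mono (ℕₚ.<⇒≤ (repunit<p^k (suc k)))) (proj₂ (p^[1+k]≤x ε 0<ε) j N≤j)

  -- The exponents differ by two: one unit is the width of the bracket around `n`, and the other
  -- absorbs the error 3 of `≤ᴿ-natApprox`, as `p^(2+k) + 2 ≤ p^(3+k)`. The threshold `3 + p` gives
  -- `n ≥ p`, so the lower exponent is at least 1.
  powerApprox : ∀ x → fromℕ (3 ℕ.+ p) ≤ᴿ x → ∃[ k ] fromℕ (p ℕ.^ suc k) ≤ᴿ x ×
    ∃[ N ] ∀ j → N ℕ.≤ j → seq x j ≤ℚ ι (p ℕ.^ (3 ℕ.+ k))
  powerApprox x 3+p≤x =
    let n , p≤n , N , near = ≤ᴿ-natApprox x p 3+p≤x
        k , p^≤n , n<p^ = bracket n p≤n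
    in k , (λ ε 0<ε → N , λ j N≤j → p≤q⇒p≤q+ε (ι (p ℕ.^ suc k)) (seq x j) 0<ε
              (ℚₚ.≤-trans (ι-mono p^≤n) (proj₁ (near j N≤j))))
         , N , λ j N≤j → ℚₚ.≤-trans (proj₂ (near j N≤j)) (ι-mono (3+n≤ n k n<p^))
    where
    bracket : ∀ n → p ℕ.≤ n → ∃[ k ] p ℕ.^ suc k ℕ.≤ n × n ℕ.< p ℕ.^ (2 ℕ.+ k)
    bracket n p≤n with powerBracket 1<p n (ℕₚ.≤-trans (s≤s z≤n) p≤n)
    ... | zero  , _ , n<p = contradiction (subst (n ℕ.<_) (ℕₚ.*-identityʳ p) n<p) (ℕₚ.≤⇒≯ p≤n)
    ... | suc k , bracket = k , bracket
    3+n≤ : ∀ n k → n ℕ.< p ℕ.^ (2 ℕ.+ k) → 3 ℕ.+ n ℕ.≤ p ℕ.^ (3 ℕ.+ k)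
    3+n≤ n k n<p^ = subst (ℕ._≤ p ℕ.^ (3 ℕ.+ k)) (cong suc (ℕₚ.+-comm n 2))
      (ℕₚ.+-mono-≤ n<p^
        (ℕₚ.≤-trans 2≤c (ℕₚ.m≤m*n c (p ℕ.^ (2 ℕ.+ k)) {{ℕₚ.m^n≢0 p (2 ℕ.+ k)}})))

  log≪max : (λ (m : MaxL p) → log (MaxL.x m)) ≪[ MaxL.x ] (λ m → fromℕ (MaxL.max m))
  log≪max = fromℕ (3 ℕ.* c) , fromℕ-pos (ℕₚ.≤-trans (ℕₚ.<⇒≤ 2≤c) (ℕₚ.m≤n*m c 3)) , fromℕ (3 ℕ.+ p) , bounded
    where
    logSum≤ : ∀ j k q M → q ≤ℚ ι (p ℕ.^ (3 ℕ.+ k)) → suc k ℕ.≤ M → ℚ.∣ logSum j q ∣ ≤ℚ ι (3 ℕ.* c) * ι M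
    logSum≤ j k q M q≤ 1+k≤M = begin
      ℚ.∣ logSum j q ∣         ≡⟨ ℚₚ.0≤p⇒∣p∣≡p (0≤recipSum (suc j) (steps j q)) ⟩
      logSum j q               ≤⟨ logSum-upper c j (3 ℕ.+ k) q q≤ ⟩
      ι (3 ℕ.+ k) * ι c        ≡⟨ ι-* (3 ℕ.+ k) c ⟨
      ι ((3 ℕ.+ k) ℕ.* c)      ≤⟨ ι-mono (ℕₚ.≤-trans ([3+k]*n≤3n*[1+k] k c) (ℕₚ.*-monoʳ-≤ (3 ℕ.* c) 1+k≤M)) ⟩
      ι (3 ℕ.* c ℕ.* M)        ≡⟨ ι-* (3 ℕ.* c) M ⟩
      ι (3 ℕ.* c) * ι M        ∎
      where open ℚₚ.≤-Reasoning
    bounded : ∀ (m : MaxL p) → fromℕ (3 ℕ.+ p) ≤ᴿ MaxL.x m →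
              ∣ log (MaxL.x m) ∣ᴿ ≤ᴿ fromℕ (3 ℕ.* c) *ᴿ fromℕ (MaxL.max m)
    bounded m 3+p≤x ε 0<ε =
      let k , p^[1+k]≤x , N , x≤ = powerApprox (MaxL.x m) 3+p≤x in
      N , λ j N≤j → p≤q⇒p≤q+ε ℚ.∣ logSum j (seq (MaxL.x m) j) ∣ (ι (3 ℕ.* c) * ι (MaxL.max m)) 0<ε
        (logSum≤ j k (seq (MaxL.x m) j) (MaxL.max m) (x≤ j N≤j) (1+k≤max m k p^[1+k]≤x))

corollary6 : (p : ℕ) → Prime p → ¬ (2 ∣ p) →
    ((λ (n : ℕ) → fromℕ ∣ L p n ∣) ≪[ fromℕ ] (λ (n : ℕ) → log (fromℕ n)))
    ×
    ((λ (m : MaxL p) → fromℕ (MaxL.max m)) ≍[ MaxL.x ] (λ (m : MaxL p) → log (MaxL.x m)))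
corollary6 zero    p-prime _   = contradiction p-prime ¬prime[0]
corollary6 (suc c) p-prime 2∤p =
  ∣L∣≪log p-prime 2∤p , max≪log p-prime 2∤p , log≪max p-prime 2∤p
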